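{- Let $D=(V,A)$ be a finite loopless digraph, $F\subseteq A$ a non-empty subset of edges, and $B$ an integral $0$-base-polyhedron. Let $f:A\to\mathbb{Z}\cup\{ -\infty\}$, $g:A\to\mathbb{Z}\cup\{+\infty\}$ with $f\le g$ be such that $Q(f,g;B)\cap\mathbb{Z}^A$ is non-empty. Then there exists an $F$-dec-min element of $Q(f,g;B)\cap\mathbb{Z}^A$ if and only if the digraph $D^*=(V,A^*)$ has no directed circuit containing an edge of $F$.
   Context: For $x\in\mathbb{R}^V$, $\widetilde x(Z)=\sum_{v\in Z}x(v)$. A base-polyhedron is $B'(p)=\{x:\widetilde x(V)=p(V),\ \widetilde x(Z)\ge p(Z)\ \forall Z\subset V\}$ with $p:2^V\to\mathbb{Z}\cup\{ -\infty\}$, $p(\emptyset)=0$, $p(V)$ finite, $p(X)+p(Y)\le p(X\cap Y)+p(X\cup Y)$; $0$-base-polyhedron: $p(V)=0$; integral: $p$ integer-valued where finite. For $x:A\to\mathbb{R}$, $\psi_x(v)=\sum_{uv\in A}x(uv)-\sum_{vu\in A}x(vu)$; $Q(f,g;B)=\{x\in\mathbb{R}^A:f\le x\le g,\ \psi_x\in B\}$. Let $\mathcal P=\{Z\subseteq V:\min\{\widetilde x(Z):x\in B\}>-\infty\}$; it is closed under union and intersection and contains $V$, so each $u\in V$ lies in a unique smallest member $P(u)$ of $\mathcal P$. Jumping edges: $J=\{uv: v\in P(u)-u\}$. Let $A_1=\{e\in A: f(e)=-\infty\}$ (edges of $D$, same orientation) and $A_2=\{vu: uv\in A-F,\ g(uv)=+\infty\}$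 (reversed copies). $A^*$ is the disjoint union $J\cup A_1\cup A_2$ (a multigraph); the edges of $F$ that can occur in $A^*$ are those of $A_1\cap F$. For $y,y'\in\mathbb{R}^F$, $y$ is decreasingly smaller than $y'$ if its decreasingly sorted component sequence is lexicographically smaller; $z\in S$ is $F$-dec-min in $S$ if no $z'\in S$ has $z'|_F$ decreasingly smaller than $z|_F$. -}

module Defs where

open import Data.Nat as ℕ using (ℕ; zero; suc)
open import Data.Integer as ℤ using (ℤ; 0ℤ)
open import Data.Integer.Properties as ℤP using ()
open import Data.Rational as ℚ using (ℚ; 0ℚ)
open import Data.Fin using (Fin; zero; suc; toℕ; fromℕ<; _≟_)
open import Data.Fin.Subset using (Subset; inside; outside; _∈_; _∉_; _∩_; _∪_) renaming (⊤ to Full)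
open import Data.Vec using (Vec; []; _∷_; lookup)
open import Data.List using (List; []; _∷_; reverse)
open import Data.List.Relation.Binary.Lex.Core using (Lex-<)
open import Data.Product using (Σ; _×_; _,_; ∃)
open import Data.Empty using (⊥)
open import Data.Unit using (⊤)
open import Relation.Nullary using (¬_; yes; no)
open import Relation.Binary.PropositionalEquality using (_≡_; _≢_)
open import Function using (_∘_)
open import Function.Definitions using (Injective)
import Data.List.Sort

data ℤ₋∞ : Set where
  -∞  : ℤ₋∞
  fin : ℤ → ℤ₋∞

data ℤ₊∞ : Set where
  fin : ℤ → ℤ₊∞
  +∞  : ℤ₊∞

_+₋_ : ℤ₋∞ → ℤ₋∞ → ℤ₋∞
-∞    +₋ _     = -∞
fin a +₋ -∞    = -∞
fin a +₋ fin b = fin (a ℤ.+ b)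

_≤₋_ : ℤ₋∞ → ℤ₋∞ → Set
-∞    ≤₋ _     = ⊤
fin a ≤₋ -∞    = ⊥
fin a ≤₋ fin b = a ℤ.≤ b

_≤ₗ_ : ℤ₋∞ → ℤ → Set
-∞    ≤ₗ _ = ⊤
fin a ≤ₗ x = a ℤ.≤ x

_≤ᵤ_ : ℤ → ℤ₊∞ → Set
x ≤ᵤ fin b = x ℤ.≤ b
x ≤ᵤ +∞    = ⊤

_≤₋₊_ : ℤ₋∞ → ℤ₊∞ → Set
-∞    ≤₋₊ _     = ⊤
fin a ≤₋₊ fin b = a ℤ.≤ b
fin a ≤₋₊ +∞    = ⊤

_≤ℚ_ : ℤ₋∞ → ℚ → Set
-∞    ≤ℚ _ = ⊤
fin a ≤ℚ q = (a ℚ./ 1) ℚ.≤ q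

_≡ₗ_ : ℤ₋∞ → ℤ → Set
-∞    ≡ₗ _ = ⊥
fin a ≡ₗ x = a ≡ x

_≡ℚ_ : ℤ₋∞ → ℚ → Set
-∞    ≡ℚ _ = ⊥
fin a ≡ℚ q = (a ℚ./ 1) ≡ q

sumℤ : ∀ {n} → (Fin n → ℤ) → ℤ
sumℤ {zero}  _ = 0ℤ
sumℤ {suc n} x = x zero ℤ.+ sumℤ (x ∘ suc)

sumℚ : ∀ {n} → (Fin n → ℚ) → ℚ
sumℚ {zero}  _ = 0ℚ
sumℚ {suc n} x = x zero ℚ.+ sumℚ (x ∘ suc)

tildeℤ : ∀ {n} → (Fin n → ℤ) → Subset n → ℤ
tildeℤ x Z = sumℤ (λ v → sel (lookup Z v) (x v))
  where
  sel : _ → ℤ → ℤ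
  sel inside  a = a
  sel outside _ = 0ℤ

tildeℚ : ∀ {n} → (Fin n → ℚ) → Subset n → ℚ
tildeℚ x Z = sumℚ (λ v → sel (lookup Z v) (x v))
  where
  sel : _ → ℚ → ℚ
  sel inside  a = a
  sel outside _ = 0ℚ

Supermodular : ∀ {n} → (Subset n → ℤ₋∞) → Set
Supermodular p = ∀ X Y → (p X +₋ p Y) ≤₋ (p (X ∩ Y) +₋ p (X ∪ Y))

InBℤ : ∀ {n} → (Subset n → ℤ₋∞) → (Fin n → ℤ) → Set
InBℤ p x = (p Full ≡ₗ tildeℤ x Full) × (∀ Z → p Z ≤ₗ tildeℤ x Z)

InBℚ : ∀ {n} → (Subset n → ℤ₋∞) → (Fin n → ℚ) → Set
InBℚ p x = (p Full ≡ℚ tildeℚ x Full) × (∀ Z → p Z ≤ℚ tildeℚ x Z)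

-- Z ∈ 𝒫 : min { x̃(Z) : x ∈ B } > -∞, i.e. x̃(Z) is bounded below on B
InCalP : ∀ {n} → (Subset n → ℤ₋∞) → Subset n → Set
InCalP p Z = ∃ λ (k : ℚ) → ∀ x → InBℚ p x → k ℚ.≤ tildeℚ x Z

-- v ∈ P(u) - u, where P(u) is the smallest member of 𝒫 containing u
-- (= intersection of all members of 𝒫 containing u)
Jumping : ∀ {n} → (Subset n → ℤ₋∞) → Fin n → Fin n → Set
Jumping p u v = u ≢ v × (∀ Z → InCalP p Z → u ∈ Z → v ∈ Z)

ψ : ∀ {n m} → (tail head : Fin m → Fin n) → (Fin m → ℤ) → Fin n → ℤ
ψ tail head x v = sumℤ (λ e → inc (head e ≟ v) (x e)) ℤ.- sumℤ (λ e → inc (tail e ≟ v) (x e))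
  where
  inc : ∀ {a b : Fin _} → Relation.Nullary.Dec (a ≡ b) → ℤ → ℤ
  inc (yes _) y = y
  inc (no  _) _ = 0ℤ

InQℤ : ∀ {n m} → (tail head : Fin m → Fin n) → (f : Fin m → ℤ₋∞) → (g : Fin m → ℤ₊∞) →
       (p : Subset n → ℤ₋∞) → (Fin m → ℤ) → Set
InQℤ tail head f g p x = (∀ e → f e ≤ₗ x e) × (∀ e → x e ≤ᵤ g e) × InBℤ p (ψ tail head x)

restrict : ∀ {m} → Subset m → (Fin m → ℤ) → List ℤ
restrict []            x = []
restrict (outside ∷ F) x = restrict F (x ∘ suc)
restrict (inside  ∷ F) x = x zero ∷ restrict F (x ∘ suc)

open Data.List.Sort ℤP.≤-decTotalOrder using (sort)

sortDec : List ℤ → List ℤ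
sortDec l = reverse (sort l)

DecSmaller : ∀ {m} → Subset m → (Fin m → ℤ) → (Fin m → ℤ) → Set
DecSmaller F y y' = Lex-< _≡_ ℤ._<_ (sortDec (restrict F y)) (sortDec (restrict F y'))

FDecMin : ∀ {m} → Subset m → ((Fin m → ℤ) → Set) → (Fin m → ℤ) → Set
FDecMin F S z = S z × ¬ (∃ λ z' → S z' × DecSmaller F z' z)

data StarArc {n m} (tail head : Fin m → Fin n) (F : Subset m)
             (f : Fin m → ℤ₋∞) (g : Fin m → ℤ₊∞) (p : Subset n → ℤ₋∞)
             (u v : Fin n) : Set where
  jump : Jumping p u v → StarArc tail head F f g p u v
  fwd  : (e : Fin m) → f e ≡ -∞ → tail e ≡ u → head e ≡ v →
         StarArc tail head F f g p u v
  bwd  : (e : Fin m) → e ∉ F → g e ≡ +∞ → tail e ≡ v → head e ≡ u →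
         StarArc tail head F f g p u v

IsFArc : ∀ {n m} {tail head : Fin m → Fin n} {F : Subset m} {f g p} {u v : Fin n} →
         StarArc tail head F f g p u v → Set
IsFArc {F = F} (jump _)          = ⊥
IsFArc {F = F} (fwd e _ _ _)     = e ∈ F
IsFArc {F = F} (bwd _ _ _ _ _)   = ⊥

next : ∀ {k} → Fin (suc k) → Fin (suc k)
next {k} i with suc (toℕ i) ℕ.<? suc k
... | yes lt = fromℕ< lt
... | no  _  = zero

HasFCircuit : ∀ {n m} → (tail head : Fin m → Fin n) → (F : Subset m) →
              (f : Fin m → ℤ₋∞) → (g : Fin m → ℤ₊∞) → (p : Subset n → ℤ₋∞) → Set
HasFCircuit {n} tail head F f g p =
  Σ ℕ λ k → Σ (Fin (suc k) → Fin n) λ w →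
    Injective _≡_ _≡_ w ×
    Σ ((i : Fin (suc k)) → StarArc tail head F f g p (w i) (w (next i))) λ arcs →
      ∃ λ i → IsFArc (arcs i)

{-# OPTIONS --safe #-}
-- A circuit of D* through F lets every dec-min candidate be improved: adding -1 on its arcs from A₁
-- and +1 on its arcs from A₂ changes ψ by unit steps along the jumping edges, which stay in B.
-- Conversely, suppose there is none. For e ∈ F with f(e) = -∞ the vertices from which tail(e) is
-- reachable miss head(e); their complement X has p(X) finite, and p(X) ≤ ψ(X) bounds x(e) from below
-- as soon as x is bounded above on F. So only finitely many restrictions to F compete, and it can be
-- decided which of them extend to an element of Q: Fourier–Motzkin elimination of one edge turns the
-- constraints given by a supermodular function into constraints of the same kind.
module Submission where

open import Defs
open import Data.Nat as ℕ using (ℕ; zero; suc)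
import Data.Nat.Properties as ℕP
import Data.Nat.Coprimality as Coprimality
open import Data.Bool using (Bool; true; false; if_then_else_; _∧_; _∨_)
open import Data.Integer as ℤ using (ℤ; 0ℤ; 1ℤ; -1ℤ; -[1+_]; ∣_∣; _+_; _-_; -_)
import Data.Integer.Properties as ℤP
open import Data.Integer.Tactic.RingSolver using (solve-∀)
open import Data.Rational as ℚ using (ℚ; mkℚ; ↥_; ↧_)
import Data.Rational.Properties as ℚP
open import Data.Fin using (Fin; zero; suc; _≟_; toℕ; inject₁; fromℕ; fromℕ<)
import Data.Fin.Properties as FinP
open import Data.Fin.Subset using (Subset; inside; outside; _∈_; _∉_; _∩_; _∪_; ∁; _⊆_; _⊃_; ⁅_⁆; Nonempty)
  renaming (⊥ to Empty; ⊤ to Full)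
open import Data.Fin.Subset.Properties
open import Data.Fin.Subset.Induction using (⊃-wellFounded; Acc; acc)
open import Data.List as List using (List; []; _∷_; reverse; foldr; upTo; cartesianProductWith)
import Data.List.Properties as ListP
open import Data.List.Membership.Propositional using () renaming (_∈_ to _∈ₗ_)
import Data.List.Membership.Propositional.Properties as ∈ₗP
open import Data.List.Relation.Unary.All as All using (All; []; _∷_)
open import Data.List.Relation.Unary.AllPairs using (AllPairs; []; _∷_)
import Data.List.Relation.Unary.AllPairs.Properties as AllPairsP
open import Data.List.Relation.Unary.Any using (here; there)
open import Data.List.Relation.Unary.Sorted.TotalOrder.Properties using (Sorted⇒AllPairs)
open import Data.List.Relation.Binary.Lex.Core using (Lex-<; halt; this) renaming (next to tie)
import Data.List.Relation.Binary.Lex.Strict as Lex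
open import Data.List.Relation.Binary.Permutation.Propositional as Perm using (_↭_)
import Data.List.Relation.Binary.Permutation.Propositional.Properties as PermP
open import Data.List.Relation.Binary.Pointwise using (Pointwise; []; _∷_)
open import Data.List.Sort ℤP.≤-decTotalOrder using (sort; sort-↭; sort-↗)
open import Data.Vec using ([]; _∷_; here; there; lookup)
import Data.Vec.Functional as Vector
import Data.Vec.Properties as VecP
open import Data.Product using (Σ; _,_; proj₁; proj₂; _×_; ∃)
open import Data.Sum using (_⊎_; inj₁; inj₂)
open import Data.Unit using (tt)
open import Data.Empty using (⊥-elim)
open import Algebra.Properties.CommutativeSemigroup ℤP.+-commutativeSemigroup using (interchange)
open import Level using (0ℓ)
open import Function using (_∘_; id; flip; case_of_)
open import Function.Bundles using (_⇔_; mk⇔)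
open import Function.Definitions using (Injective)
open import Relation.Nullary using (¬_; Dec; yes; no; does; ¬?; contradiction)
open import Relation.Nullary.Decidable using (map′; _→-dec_; _×-dec_; _⊎-dec_; decidable-stable)
open import Relation.Binary using (Rel; tri<; tri≈; tri>)
open import Relation.Binary.PropositionalEquality
import Data.List.Relation.Binary.Permutation.Setoid.Properties (setoid ℤ) as PermS

-- Decreasing order

-- The existence half must compute a minimiser, so each choice in it needs a decision procedure. Two
-- notions resist this. Membership in 𝒫 quantifies over all rational points of B. It is traded for
-- finiteness of `p`, which gives the same jumping edges once B has a point of the form `ψ x`. And
-- the edges off F may range over infinitely many values, so whether a restriction to F extends to Q
-- cannot be settled by search; this is why variables are eliminated. Elimination stays exact over
-- the integers because an edge has coefficient 0, 1 or -1 in each constraint, so every bound on a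
-- single edge is an integer. Membership of ψ in B becomes a system of lower bounds on net in-flow;
-- the equation at V holds by itself, both sides being 0. The bound from above on F is that of the
-- given element of Q: going decreasingly down never raises the maximum on F. It also explains why
-- A₂ leaves out F: that maximum stands in for a missing upper bound there, while elsewhere an
-- infinite upper bound has to be answered by a reversed arc.

infix 4 _<lex_
_<lex_ : List ℤ → List ℤ → Set
_<lex_ = Lex-< _≡_ ℤ._<_

<lex-trans : ∀ {k l r} → k <lex l → l <lex r → k <lex r
<lex-trans = Lex.<-transitive isEquivalence (resp₂ ℤ._<_) ℤP.<-trans

<lex-irrefl : ∀ {l} → ¬ (l <lex l)
<lex-irrefl (this x<x)  = ℤP.<-irrefl refl x<x
<lex-irrefl (tie _ l<l) = <lex-irrefl l<l

_<lex?_ : ∀ k l → Dec (k <lex l)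
_<lex?_ = Lex.<-decidable ℤ._≟_ ℤ._<?_

AllPairs-reverse⁺ : ∀ {R : Rel ℤ 0ℓ} {l} → AllPairs R l → AllPairs (flip R) (reverse l)
AllPairs-reverse⁺ [] = []
AllPairs-reverse⁺ {R} {x ∷ l} (px ∷ pl) = subst (AllPairs (flip R)) (sym (ListP.unfold-reverse x l))
  (AllPairsP.++⁺ (AllPairs-reverse⁺ pl) ([] ∷ [])
    (All.map (_∷ []) (PermP.All-resp-↭ (Perm.↭-sym (PermP.↭-reverse l)) px)))

Descending : List ℤ → Set
Descending = AllPairs ℤ._≥_

sortDec-descending : ∀ l → Descending (sortDec l)
sortDec-descending l = AllPairs-reverse⁺ (Sorted⇒AllPairs ℤP.≤-totalOrder (sort-↗ l))

sortDec-↭ : ∀ l → sortDec l ↭ l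
sortDec-↭ l = Perm.↭-trans (PermP.↭-reverse (sort l)) (sort-↭ l)

count≥ : ℤ → List ℤ → ℕ
count≥ t []      = 0
count≥ t (x ∷ l) = if does (t ℤ.≤? x) then suc (count≥ t l) else count≥ t l

count≥-↭ : ∀ t {k l} → k ↭ l → count≥ t k ≡ count≥ t l
count≥-↭ t Perm.refl = refl
count≥-↭ t (Perm.prep x p) with t ℤ.≤? x
... | yes _ = cong suc (count≥-↭ t p)
... | no  _ = count≥-↭ t p
count≥-↭ t (Perm.swap x y p) with t ℤ.≤? x | t ℤ.≤? y
... | yes _ | yes _ = cong (2 ℕ.+_) (count≥-↭ t p)
... | yes _ | no  _ = cong suc (count≥-↭ t p)
... | no  _ | yes _ = cong suc (count≥-↭ t p)
... | no  _ | no  _ = count≥-↭ t p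
count≥-↭ t (Perm.trans p q) = trans (count≥-↭ t p) (count≥-↭ t q)

count≥-mono : ∀ t {k l} → Pointwise ℤ._≤_ k l → count≥ t k ℕ.≤ count≥ t l
count≥-mono t [] = ℕ.z≤n
count≥-mono t (_∷_ {x} {y} x≤y k≤l) with t ℤ.≤? x | t ℤ.≤? y
... | yes _   | yes _   = ℕ.s≤s (count≥-mono t k≤l)
... | yes t≤x | no  t≰y = ⊥-elim (t≰y (ℤP.≤-trans t≤x x≤y))
... | no  _   | yes _   = ℕP.m≤n⇒m≤1+n (count≥-mono t k≤l)
... | no  _   | no  _   = count≥-mono t k≤l

count≥-none : ∀ {t l} → All (ℤ._< t) l → count≥ t l ≡ 0
count≥-none [] = refl
count≥-none {t} {x ∷ _} (x<t ∷ l<t) with t ℤ.≤? x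
... | yes t≤x = ⊥-elim (ℤP.<⇒≱ x<t t≤x)
... | no  _   = count≥-none l<t

count≥-head : ∀ x l → count≥ x (x ∷ l) ≡ suc (count≥ x l)
count≥-head x l with x ℤ.≤? x
... | yes _ = refl
... | no  x≰x = ⊥-elim (x≰x ℤP.≤-refl)

count≥-tail : ∀ t x k l → count≥ t (x ∷ k) ℕ.≤ count≥ t (x ∷ l) → count≥ t k ℕ.≤ count≥ t l
count≥-tail t x k l le with t ℤ.≤? x
... | yes _ = ℕ.s≤s⁻¹ le
... | no  _ = le

-- Compare heads. If the head of `k` were the larger, the threshold at it would count an entry of
-- `k` and none of `l`; equal heads add the same to every count and can be stripped. Counts ignore
-- order, so they carry a pointwise comparison of unsorted lists over to the sorted ones.
descending-dominated : ∀ {k l} → Descending k → Descending l →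
  (∀ t → count≥ t k ℕ.≤ count≥ t l) → k <lex l ⊎ k ≡ l
descending-dominated {[]} {[]} _ _ _ = inj₂ refl
descending-dominated {[]} {_ ∷ _} _ _ _ = inj₁ halt
descending-dominated {x ∷ k} {[]} _ _ dom with subst (ℕ._≤ 0) (count≥-head x k) (dom x)
... | ()
descending-dominated {x ∷ k} {y ∷ l} (_ ∷ dk) (l≤y ∷ dl) dom with ℤP.<-cmp x y
... | tri< x<y _ _ = inj₁ (this x<y)
... | tri> _ _ y<x with subst₂ ℕ._≤_ (count≥-head x k)
                     (count≥-none (y<x ∷ All.map (λ z≤y → ℤP.≤-<-trans z≤y y<x) l≤y)) (dom x)
...   | ()
descending-dominated {x ∷ k} {_ ∷ l} (_ ∷ dk) (_ ∷ dl) dom | tri≈ _ refl _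
  with descending-dominated dk dl (λ t → count≥-tail t x k l (dom t))
... | inj₁ k<l = inj₁ (tie refl k<l)
... | inj₂ k≡l = inj₂ (cong (x ∷_) k≡l)

sum : List ℤ → ℤ
sum = foldr _+_ 0ℤ

sum-↭ : ∀ {k l} → k ↭ l → sum k ≡ sum l
sum-↭ p = PermS.foldr-commMonoid ℤP.+-0-isCommutativeMonoid (Perm.↭⇒↭ₛ p)

-- The threshold counts leave only "smaller" or "equal" for the sorted lists, and equality would
-- force equal sums, since a sum survives permutation.
sortDec-strictly-monotone : ∀ {k l} → Pointwise ℤ._≤_ k l → sum k ℤ.< sum l → sortDec k <lex sortDec l
sortDec-strictly-monotone {k} {l} k≤l Σk<Σl
  with descending-dominated (sortDec-descending k) (sortDec-descending l)
         (λ t → subst₂ ℕ._≤_ (sym (count≥-↭ t (sortDec-↭ k))) (sym (count≥-↭ t (sortDec-↭ l)))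
                  (count≥-mono t k≤l))
... | inj₁ lt = lt
... | inj₂ eq = ⊥-elim (ℤP.<-irrefl Σk≡Σl Σk<Σl)
  where
  Σk≡Σl : sum k ≡ sum l
  Σk≡Σl = trans (sym (sum-↭ (sortDec-↭ k))) (trans (cong sum eq) (sum-↭ (sortDec-↭ l)))

restrict-mono : ∀ {m} (F : Subset m) {x y} → (∀ e → e ∈ F → x e ℤ.≤ y e) →
  Pointwise ℤ._≤_ (restrict F x) (restrict F y)
restrict-mono [] x≤y = []
restrict-mono (outside ∷ F) x≤y = restrict-mono F (λ e → x≤y (suc e) ∘ there)
restrict-mono (inside ∷ F) x≤y = x≤y zero here ∷ restrict-mono F (λ e → x≤y (suc e) ∘ there)

sum-mono : ∀ {k l} → Pointwise ℤ._≤_ k l → sum k ℤ.≤ sum l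
sum-mono [] = ℤP.≤-refl
sum-mono (x≤y ∷ k≤l) = ℤP.+-mono-≤ x≤y (sum-mono k≤l)

sum-restrict-< : ∀ {m} (F : Subset m) {x y} → (∀ e → e ∈ F → x e ℤ.≤ y e) →
  ∀ e → e ∈ F → x e ℤ.< y e → sum (restrict F x) ℤ.< sum (restrict F y)
sum-restrict-< (inside ∷ F) x≤y zero here x<y =
  ℤP.+-mono-<-≤ x<y (sum-mono (restrict-mono F (λ e → x≤y (suc e) ∘ there)))
sum-restrict-< (outside ∷ F) x≤y (suc e) (there e∈F) x<y =
  sum-restrict-< F (λ e → x≤y (suc e) ∘ there) e e∈F x<y
sum-restrict-< (inside ∷ F) x≤y (suc e) (there e∈F) x<y =
  ℤP.+-mono-≤-< (x≤y zero here) (sum-restrict-< F (λ e → x≤y (suc e) ∘ there) e e∈F x<y)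

decSmaller-pointwise : ∀ {m} (F : Subset m) {x y} → (∀ e → e ∈ F → x e ℤ.≤ y e) →
  ∀ e → e ∈ F → x e ℤ.< y e → DecSmaller F x y
decSmaller-pointwise F x≤y e e∈F x<y =
  sortDec-strictly-monotone (restrict-mono F x≤y) (sum-restrict-< F x≤y e e∈F x<y)

restrict-cong : ∀ {m} (F : Subset m) {x y} → (∀ e → e ∈ F → x e ≡ y e) → restrict F x ≡ restrict F y
restrict-cong [] x≗y = refl
restrict-cong (outside ∷ F) x≗y = restrict-cong F (λ e → x≗y (suc e) ∘ there)
restrict-cong (inside ∷ F) x≗y = cong₂ _∷_ (x≗y zero here) (restrict-cong F (λ e → x≗y (suc e) ∘ there))

restrict-All⁺ : ∀ {m} {P : ℤ → Set} (F : Subset m) {x} → (∀ e → e ∈ F → P (x e)) → All P (restrict F x)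
restrict-All⁺ [] Px = []
restrict-All⁺ (outside ∷ F) Px = restrict-All⁺ F (λ e → Px (suc e) ∘ there)
restrict-All⁺ (inside ∷ F) Px = Px zero here ∷ restrict-All⁺ F (λ e → Px (suc e) ∘ there)

restrict-All⁻ : ∀ {m} {P : ℤ → Set} (F : Subset m) {x} → All P (restrict F x) → ∀ e → e ∈ F → P (x e)
restrict-All⁻ (inside ∷ F) (p ∷ _) zero here = p
restrict-All⁻ (outside ∷ F) ps (suc e) (there e∈F) = restrict-All⁻ F ps e e∈F
restrict-All⁻ (inside ∷ F) (_ ∷ ps) (suc e) (there e∈F) = restrict-All⁻ F ps e e∈F

<lex-All≤ : ∀ {k l M} → Descending k → k <lex l → All (ℤ._≤ M) l → All (ℤ._≤ M) k
<lex-All≤ _ halt _ = []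
<lex-All≤ (k≤x ∷ _) (this x<y) (y≤M ∷ _) = x≤M ∷ All.map (λ z≤x → ℤP.≤-trans z≤x x≤M) k≤x
  where x≤M = ℤP.≤-trans (ℤP.<⇒≤ x<y) y≤M
<lex-All≤ (_ ∷ dk) (tie refl k<l) (y≤M ∷ l≤M) = y≤M ∷ <lex-All≤ dk k<l l≤M

-- A descending list is bounded by its head, and a lexicographically smaller list cannot have a
-- larger head. This is what confines all competitors from above.
decSmaller-bound : ∀ {m} (F : Subset m) {x y M} → DecSmaller F x y →
  (∀ e → e ∈ F → y e ℤ.≤ M) → ∀ e → e ∈ F → x e ℤ.≤ M
decSmaller-bound F {x} {y} x<y y≤M = restrict-All⁻ F
  (PermP.All-resp-↭ (sortDec-↭ (restrict F x))
    (<lex-All≤ (sortDec-descending (restrict F x)) x<y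
      (PermP.All-resp-↭ (Perm.↭-sym (sortDec-↭ (restrict F y))) (restrict-All⁺ F y≤M))))

-- Net in-flow of a vertex set

sumℤ-cong : ∀ {n} {x y : Fin n → ℤ} → (∀ i → x i ≡ y i) → sumℤ x ≡ sumℤ y
sumℤ-cong {zero}  x≗y = refl
sumℤ-cong {suc n} x≗y = cong₂ _+_ (x≗y zero) (sumℤ-cong (x≗y ∘ suc))

sumℤ-+ : ∀ {n} (x y : Fin n → ℤ) → sumℤ (λ i → x i + y i) ≡ sumℤ x + sumℤ y
sumℤ-+ {zero}  x y = refl
sumℤ-+ {suc n} x y = trans (cong (x zero + y zero +_) (sumℤ-+ (x ∘ suc) (y ∘ suc)))
  (interchange (x zero) (y zero) _ (sumℤ (y ∘ suc)))

sumℤ-neg : ∀ {n} (x : Fin n → ℤ) → sumℤ (λ i → - x i) ≡ - sumℤ x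
sumℤ-neg {zero}  x = refl
sumℤ-neg {suc n} x = trans (cong (- x zero +_) (sumℤ-neg (x ∘ suc))) (sym (ℤP.neg-distrib-+ (x zero) _))

sumℤ-minus : ∀ {n} (x y : Fin n → ℤ) → sumℤ (λ i → x i - y i) ≡ sumℤ x - sumℤ y
sumℤ-minus x y = trans (sumℤ-+ x (-_ ∘ y)) (cong (sumℤ x +_) (sumℤ-neg y))

sumℤ-zero : ∀ n → sumℤ {n} (λ _ → 0ℤ) ≡ 0ℤ
sumℤ-zero zero    = refl
sumℤ-zero (suc n) = trans (ℤP.+-identityˡ _) (sumℤ-zero n)

sumℤ-mono : ∀ {n} {x y : Fin n → ℤ} → (∀ i → x i ℤ.≤ y i) → sumℤ x ℤ.≤ sumℤ y
sumℤ-mono {zero}  x≤y = ℤP.≤-refl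
sumℤ-mono {suc n} x≤y = ℤP.+-mono-≤ (x≤y zero) (sumℤ-mono (x≤y ∘ suc))

sumℤ-≥0 : ∀ {n} {x : Fin n → ℤ} → (∀ i → 0ℤ ℤ.≤ x i) → 0ℤ ℤ.≤ sumℤ x
sumℤ-≥0 {n} {x} 0≤x = subst (ℤ._≤ sumℤ x) (sumℤ-zero n) (sumℤ-mono 0≤x)

sumℤ-≤0 : ∀ {n} {x : Fin n → ℤ} → (∀ i → x i ℤ.≤ 0ℤ) → sumℤ x ℤ.≤ 0ℤ
sumℤ-≤0 {n} {x} x≤0 = subst (sumℤ x ℤ.≤_) (sumℤ-zero n) (sumℤ-mono x≤0)

sumℤ-<0 : ∀ {n} {x : Fin n → ℤ} → (∀ i → x i ℤ.≤ 0ℤ) → ∀ i → x i ℤ.< 0ℤ → sumℤ x ℤ.< 0ℤ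
sumℤ-<0 x≤0 zero    x<0 = ℤP.+-mono-<-≤ x<0 (sumℤ-≤0 (x≤0 ∘ suc))
sumℤ-<0 x≤0 (suc i) x<0 = ℤP.+-mono-≤-< (x≤0 zero) (sumℤ-<0 (x≤0 ∘ suc) i x<0)

summand≤sumℤ : ∀ {n} {x : Fin n → ℤ} → (∀ i → 0ℤ ℤ.≤ x i) → ∀ i → x i ℤ.≤ sumℤ x
summand≤sumℤ {x = x} 0≤x zero = subst (ℤ._≤ sumℤ x) (ℤP.+-identityʳ (x zero))
  (ℤP.+-monoʳ-≤ (x zero) (sumℤ-≥0 (0≤x ∘ suc)))
summand≤sumℤ {x = x} 0≤x (suc i) = subst (ℤ._≤ sumℤ x) (ℤP.+-identityˡ (x (suc i)))
  (ℤP.+-mono-≤ (0≤x zero) (summand≤sumℤ (0≤x ∘ suc) i))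

sumℤ-snoc : ∀ {k} (h : Fin (suc k) → ℤ) → sumℤ h ≡ sumℤ (h ∘ inject₁) + h (fromℕ k)
sumℤ-snoc {zero}  h = ℤP.+-comm (h zero) 0ℤ
sumℤ-snoc {suc k} h = trans (cong (h zero +_) (sumℤ-snoc (h ∘ suc))) (sym (ℤP.+-assoc (h zero) _ _))

sumℤ-swap : ∀ {n m} (a : Fin n → Fin m → ℤ) →
  sumℤ (λ i → sumℤ (a i)) ≡ sumℤ (λ j → sumℤ (λ i → a i j))
sumℤ-swap {zero}  {m} a = sym (sumℤ-zero m)
sumℤ-swap {suc n} a = trans (cong (sumℤ (a zero) +_) (sumℤ-swap (a ∘ suc))) (sym (sumℤ-+ (a zero) _))

_when_ : ℤ → Bool → ℤ
y when b = if b then y else 0ℤ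

when-minus : ∀ b y z → (y - z) when b ≡ (y when b) - (z when b)
when-minus true  y z = refl
when-minus false y z = refl

when-comm : ∀ a b y → (y when a) when b ≡ (y when b) when a
when-comm true  true  y = refl
when-comm true  false y = refl
when-comm false true  y = refl
when-comm false false y = refl

when-sum : ∀ {m} b (x : Fin m → ℤ) → sumℤ x when b ≡ sumℤ (λ e → x e when b)
when-sum true  x = refl
when-sum {m} false x = sym (sumℤ-zero m)

sumℤ-single : ∀ {n} (i : Fin n) (x : Fin n → ℤ) → sumℤ (λ j → x j when does (i ≟ j)) ≡ x i
sumℤ-single {suc n} zero x = trans (cong (x zero +_) (sumℤ-zero n)) (ℤP.+-identityʳ _)
sumℤ-single {suc n} (suc i) x = trans (ℤP.+-identityˡ _) (sumℤ-single i (x ∘ suc))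

tildeℤ-sum : ∀ {n} (x : Fin n → ℤ) Z → tildeℤ x Z ≡ sumℤ (λ v → x v when lookup Z v)
tildeℤ-sum x [] = refl
tildeℤ-sum x (inside  ∷ Z) = cong (x zero +_) (tildeℤ-sum (x ∘ suc) Z)
tildeℤ-sum x (outside ∷ Z) = cong (0ℤ +_) (tildeℤ-sum (x ∘ suc) Z)

tildeℤ-cong : ∀ {n} {x y : Fin n → ℤ} → (∀ v → x v ≡ y v) → ∀ Z → tildeℤ x Z ≡ tildeℤ y Z
tildeℤ-cong x≗y [] = refl
tildeℤ-cong x≗y (inside  ∷ Z) = cong₂ _+_ (x≗y zero) (tildeℤ-cong (x≗y ∘ suc) Z)
tildeℤ-cong x≗y (outside ∷ Z) = cong (0ℤ +_) (tildeℤ-cong (x≗y ∘ suc) Z)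

-- The two Booleans say whether the head and the tail of an edge lie in the set. The result type is
-- left open because the same case split serves for flows in `ℤ` and for capacities and bounds in
-- `ℤ₋∞`.
cut : ∀ {A : Set} → Bool → Bool → A → A → A → A
cut true  false enter leave other = enter
cut false true  enter leave other = leave
cut _     _     enter leave other = other

cut-when : ∀ h t y → (y when h) - (y when t) ≡ cut h t y (- y) 0ℤ
cut-when true  true  y = ℤP.+-inverseʳ y
cut-when true  false y = ℤP.+-identityʳ y
cut-when false true  y = ℤP.+-identityˡ (- y)
cut-when false false y = refl

module _ {n m} (tail head : Fin m → Fin n) where

  cutAt : ∀ {A : Set} → Fin m → Subset n → A → A → A → A
  cutAt e Z = cut (lookup Z (head e)) (lookup Z (tail e))

  net : (Fin m → ℤ) → Subset n → ℤ
  net x Z = sumℤ (λ e → cutAt e Z (x e) (- x e) 0ℤ)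

  -- The local function of ψ cannot be named; unification recovers the two sums it occurs in.
  ψ-split : ∀ x v → Σ (Fin m → ℤ) λ inflow → Σ (Fin m → ℤ) λ outflow →
    ψ tail head x v ≡ sumℤ inflow - sumℤ outflow
  ψ-split x v = _ , _ , refl

  ψ-inflow : ∀ x v e → proj₁ (ψ-split x v) e ≡ x e when does (head e ≟ v)
  ψ-inflow x v e with head e ≟ v
  ... | yes _ = refl
  ... | no  _ = refl

  ψ-outflow : ∀ x v e → proj₁ (proj₂ (ψ-split x v)) e ≡ x e when does (tail e ≟ v)
  ψ-outflow x v e with tail e ≟ v
  ... | yes _ = refl
  ... | no  _ = refl

  ψ-sum : ∀ x v → ψ tail head x v ≡
    sumℤ (λ e → (x e when does (head e ≟ v)) - (x e when does (tail e ≟ v)))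
  ψ-sum x v = trans (cong₂ _-_ (sumℤ-cong (ψ-inflow x v)) (sumℤ-cong (ψ-outflow x v)))
                    (sym (sumℤ-minus (λ e → x e when does (head e ≟ v)) _))

  -- Exchanging the sums over vertices and edges leaves `x e` once for a head in `Z`, minus once for
  -- a tail in `Z`, so an edge inside `Z` cancels.
  tilde-ψ : ∀ x Z → tildeℤ (ψ tail head x) Z ≡ net x Z
  tilde-ψ x Z = begin
    tildeℤ (ψ tail head x) Z
      ≡⟨ trans (tildeℤ-cong (ψ-sum x) Z) (tildeℤ-sum _ Z) ⟩
    sumℤ (λ v → sumℤ (λ e → at head e v - at tail e v) when lookup Z v)
      ≡⟨ sumℤ-cong (λ v → trans (when-sum (lookup Z v) (λ e → at head e v - at tail e v))
           (sumℤ-cong λ e → when-minus (lookup Z v) (at head e v) _)) ⟩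
    sumℤ (λ v → sumℤ (λ e → (at head e v when lookup Z v) - (at tail e v when lookup Z v)))
      ≡⟨ sumℤ-swap (λ v e → (at head e v when lookup Z v) - (at tail e v when lookup Z v)) ⟩
    sumℤ (λ e → sumℤ (λ v → (at head e v when lookup Z v) - (at tail e v when lookup Z v)))
      ≡⟨ sumℤ-cong (λ e → trans (sumℤ-minus (λ v → at head e v when lookup Z v) _)
           (cong₂ _-_ (sum-at head e) (sum-at tail e))) ⟩
    sumℤ (λ e → (x e when lookup Z (head e)) - (x e when lookup Z (tail e)))
      ≡⟨ sumℤ-cong (λ e → cut-when (lookup Z (head e)) (lookup Z (tail e)) (x e)) ⟩
    net x Z ∎
    where
    open ≡-Reasoning
    at : (Fin m → Fin n) → Fin m → Fin n → ℤ
    at h e v = x e when does (h e ≟ v)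
    sum-at : ∀ h e → sumℤ (λ v → at h e v when lookup Z v) ≡ x e when lookup Z (h e)
    sum-at h e = trans (sumℤ-cong λ v → when-comm (does (h e ≟ v)) (lookup Z v) (x e))
                       (sumℤ-single (h e) (λ v → x e when lookup Z v))

  cutAt-∩ : ∀ {A : Set} {a b c : A} e X Y → cutAt e (X ∩ Y) a b c ≡
    cut (lookup X (head e) ∧ lookup Y (head e)) (lookup X (tail e) ∧ lookup Y (tail e)) a b c
  cutAt-∩ e X Y = cong₂ (λ h t → cut h t _ _ _)
    (VecP.lookup-zipWith _∧_ (head e) X Y) (VecP.lookup-zipWith _∧_ (tail e) X Y)

  cutAt-∪ : ∀ {A : Set} {a b c : A} e X Y → cutAt e (X ∪ Y) a b c ≡
    cut (lookup X (head e) ∨ lookup Y (head e)) (lookup X (tail e) ∨ lookup Y (tail e)) a b c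
  cutAt-∪ e X Y = cong₂ (λ h t → cut h t _ _ _)
    (VecP.lookup-zipWith _∨_ (head e) X Y) (VecP.lookup-zipWith _∨_ (tail e) X Y)

  -- Edge by edge both sides have the same two terms, except for an edge between X - Y and Y - X. It
  -- enters one set and leaves the other, so its terms cancel, and it crosses neither the
  -- intersection nor the union.
  net-modular : ∀ x X Y → net x X + net x Y ≡ net x (X ∩ Y) + net x (X ∪ Y)
  net-modular x X Y = begin
    net x X + net x Y              ≡⟨ sumℤ-+ (c X) (c Y) ⟨
    sumℤ (λ e → c X e + c Y e)   ≡⟨ sumℤ-cong (λ e →
      subst₂ (λ a b → c X e + c Y e ≡ a + b) (sym (cutAt-∩ e X Y)) (sym (cutAt-∪ e X Y)) (modular (x e)
        (lookup X (head e)) (lookup X (tail e)) (lookup Y (head e)) (lookup Y (tail e)))) ⟩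
    sumℤ (λ e → c (X ∩ Y) e + c (X ∪ Y) e) ≡⟨ sumℤ-+ (c (X ∩ Y)) (c (X ∪ Y)) ⟩
    net x (X ∩ Y) + net x (X ∪ Y) ∎
    where
    open ≡-Reasoning
    c : Subset n → Fin m → ℤ
    c Z e = cutAt e Z (x e) (- x e) 0ℤ
    modular : ∀ y h t h' t' → let δ = λ h t → cut h t y (- y) 0ℤ in
      δ h t + δ h' t' ≡ δ (h ∧ h') (t ∧ t') + δ (h ∨ h') (t ∨ t')
    modular y true  true  h'    t'    = ℤP.+-comm 0ℤ (cut h' t' y (- y) 0ℤ)
    modular y true  false true  true  = refl
    modular y true  false true  false = refl
    modular y true  false false true  = ℤP.+-inverseʳ y
    modular y true  false false false = ℤP.+-comm y 0ℤ
    modular y false true  true  true  = refl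
    modular y false true  true  false = ℤP.+-inverseˡ y
    modular y false true  false true  = refl
    modular y false true  false false = ℤP.+-comm (- y) 0ℤ
    modular y false false h'    t'    = refl

  net-+ : ∀ x y Z → net (λ e → x e + y e) Z ≡ net x Z + net y Z
  net-+ x y Z = trans (sumℤ-cong λ e → additive (lookup Z (head e)) (lookup Z (tail e)) (x e) (y e))
    (sumℤ-+ (λ e → cutAt e Z (x e) (- x e) 0ℤ) _)
    where
    additive : ∀ h t a b → cut h t (a + b) (- (a + b)) 0ℤ ≡ cut h t a (- a) 0ℤ + cut h t b (- b) 0ℤ
    additive true  true  a b = refl
    additive true  false a b = refl
    additive false true  a b = ℤP.neg-distrib-+ a b
    additive false false a b = refl

  cut-zero : ∀ h t → cut h t 0ℤ (- 0ℤ) 0ℤ ≡ 0ℤ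
  cut-zero true  true  = refl
  cut-zero true  false = refl
  cut-zero false true  = refl
  cut-zero false false = refl

  net-zero : ∀ Z → net (λ _ → 0ℤ) Z ≡ 0ℤ
  net-zero Z = trans (sumℤ-cong λ e → cut-zero (lookup Z (head e)) (lookup Z (tail e))) (sumℤ-zero m)

  net-sum : ∀ {k} (x : Fin k → Fin m → ℤ) Z →
    net (λ e → sumℤ (λ i → x i e)) Z ≡ sumℤ (λ i → net (x i) Z)
  net-sum {zero}  x Z = net-zero Z
  net-sum {suc k} x Z = trans (net-+ (x zero) _ Z) (cong (net (x zero) Z +_) (net-sum (x ∘ suc) Z))

  net-single : ∀ e y Z → net (λ e' → y when does (e ≟ e')) Z ≡ cutAt e Z y (- y) 0ℤ
  net-single e y Z = trans
    (sumℤ-cong λ e' → when-cut (does (e ≟ e')) (lookup Z (head e')) (lookup Z (tail e')))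
    (sumℤ-single e (λ e' → cutAt e' Z y (- y) 0ℤ))
    where
    when-cut : ∀ b h t → cut h t (y when b) (- (y when b)) 0ℤ ≡ cut h t y (- y) 0ℤ when b
    when-cut true  h t = refl
    when-cut false h t = cut-zero h t

  net-Full : ∀ x → net x Full ≡ 0ℤ
  net-Full x = trans (sumℤ-cong λ e → neutral (VecP.lookup-replicate (head e) inside)
                                              (VecP.lookup-replicate (tail e) inside)) (sumℤ-zero m)
    where
    neutral : ∀ {h t y} → h ≡ true → t ≡ true → cut h t y (- y) 0ℤ ≡ 0ℤ
    neutral refl refl = refl

-- Integral feasibility by Fourier–Motzkin elimination

≤₋-refl : ∀ {a} → a ≤₋ a
≤₋-refl { -∞}   = tt
≤₋-refl {fin _} = ℤP.≤-refl

≤₋-reflexive : ∀ {a b} → a ≡ b → a ≤₋ b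
≤₋-reflexive refl = ≤₋-refl

≤₋-trans : ∀ {a b c} → a ≤₋ b → b ≤₋ c → a ≤₋ c
≤₋-trans { -∞} _ _ = tt
≤₋-trans {fin _} {fin _} {fin _} a≤b b≤c = ℤP.≤-trans a≤b b≤c

≤₋-total : ∀ a b → a ≤₋ b ⊎ b ≤₋ a
≤₋-total -∞      _       = inj₁ tt
≤₋-total (fin _) -∞      = inj₂ tt
≤₋-total (fin a) (fin b) = ℤP.≤-total a b

≤₋-≤ₗ-trans : ∀ {a b x} → a ≤₋ b → b ≤ₗ x → a ≤ₗ x
≤₋-≤ₗ-trans { -∞} _ _ = tt
≤₋-≤ₗ-trans {fin _} {fin _} a≤b b≤x = ℤP.≤-trans a≤b b≤x

≤ₗ-≤-trans : ∀ {a x y} → a ≤ₗ x → x ℤ.≤ y → a ≤ₗ y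
≤ₗ-≤-trans { -∞} _ _ = tt
≤ₗ-≤-trans {fin _} a≤x x≤y = ℤP.≤-trans a≤x x≤y

≤-≤ᵤ-trans : ∀ {x y b} → x ℤ.≤ y → y ≤ᵤ b → x ≤ᵤ b
≤-≤ᵤ-trans {b = fin _} x≤y y≤b = ℤP.≤-trans x≤y y≤b
≤-≤ᵤ-trans {b = +∞}    _   _   = tt

≤ₗ? : ∀ a x → Dec (a ≤ₗ x)
≤ₗ? -∞      x = yes tt
≤ₗ? (fin a) x = a ℤ.≤? x

+₋-comm : ∀ a b → a +₋ b ≡ b +₋ a
+₋-comm -∞      -∞      = refl
+₋-comm -∞      (fin _) = refl
+₋-comm (fin _) -∞      = refl
+₋-comm (fin a) (fin b) = cong fin (ℤP.+-comm a b)

+₋-identityʳ : ∀ a → a +₋ fin 0ℤ ≡ a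
+₋-identityʳ -∞      = refl
+₋-identityʳ (fin a) = cong fin (ℤP.+-identityʳ a)

+₋-mono : ∀ {a b c d} → a ≤₋ b → c ≤₋ d → (a +₋ c) ≤₋ (b +₋ d)
+₋-mono { -∞} _ _ = tt
+₋-mono {fin _} {fin _} { -∞} _ _ = tt
+₋-mono {fin _} {fin _} {fin _} {fin _} a≤b c≤d = ℤP.+-mono-≤ a≤b c≤d

+₋-interchange : ∀ a b c d → (a +₋ b) +₋ (c +₋ d) ≡ (a +₋ c) +₋ (b +₋ d)
+₋-interchange -∞ _ _ _ = refl
+₋-interchange (fin _) -∞ -∞ _ = refl
+₋-interchange (fin _) -∞ (fin _) _ = refl
+₋-interchange (fin _) (fin _) -∞ _ = refl
+₋-interchange (fin _) (fin _) (fin _) -∞ = refl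
+₋-interchange (fin a) (fin b) (fin c) (fin d) = cong fin (interchange a b c d)

+ₗ-mono : ∀ {a b x y} → a ≤ₗ x → b ≤ₗ y → (a +₋ b) ≤ₗ (x + y)
+ₗ-mono { -∞} _ _ = tt
+ₗ-mono {fin _} { -∞} _ _ = tt
+ₗ-mono {fin _} {fin _} a≤x b≤y = ℤP.+-mono-≤ a≤x b≤y

_-ₗ_ : ℤ₋∞ → ℤ → ℤ₋∞
a -ₗ x = a +₋ fin (- x)

-ₗ-pair : ∀ {a b x y} → (a +₋ b) ≤ₗ (x + y) → ((a -ₗ x) +₋ (b -ₗ y)) ≤ₗ 0ℤ
-ₗ-pair { -∞} _ = tt
-ₗ-pair {fin _} { -∞} _ = tt
-ₗ-pair {fin a} {fin b} {x} {y} a+b≤x+y =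
  subst₂ ℤ._≤_ (lhs a b x y) (ℤP.+-inverseʳ (x + y)) (ℤP.+-monoˡ-≤ (- (x + y)) a+b≤x+y)
  where
  lhs : ∀ a b x y → a + b - (x + y) ≡ a - x + (b - y)
  lhs = solve-∀

-ₗ-right : ∀ {a c x} → (a +₋ c) ≤ₗ x → ((a -ₗ x) +₋ c) ≤ₗ 0ℤ
-ₗ-right {a} {c} {x} a+c≤x = subst (λ d → ((a -ₗ x) +₋ d) ≤ₗ 0ℤ) (+₋-identityʳ c)
  (-ₗ-pair {a} {c} {x} {0ℤ} (subst ((a +₋ c) ≤ₗ_) (sym (ℤP.+-identityʳ x)) a+c≤x))

-ₗ-left : ∀ {a c x} → (a +₋ c) ≤ₗ x → (c +₋ (a -ₗ x)) ≤ₗ 0ℤ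
-ₗ-left {a} {c} {x} a+c≤x = subst (_≤ₗ 0ℤ) (+₋-comm (a -ₗ x) c) (-ₗ-right {a} {c} {x} a+c≤x)

-ₗ-elim : ∀ {a x t} → (a -ₗ x) ≤ₗ t → a ≤ₗ (t + x)
-ₗ-elim { -∞} _ = tt
-ₗ-elim {fin a} {x} {t} a-x≤t = subst (ℤ._≤ t + x) (lhs a x) (ℤP.+-monoˡ-≤ x a-x≤t)
  where
  lhs : ∀ a x → a - x + x ≡ a
  lhs = solve-∀

neg₊ : ℤ₊∞ → ℤ₋∞
neg₊ (fin b) = fin (- b)
neg₊ +∞      = -∞

neg₊-≤ₗ : ∀ {x g} → x ≤ᵤ g → neg₊ g ≤ₗ (- x)
neg₊-≤ₗ {g = fin _} x≤g = ℤP.neg-mono-≤ x≤g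
neg₊-≤ₗ {g = +∞}    _   = tt

neg₊-≤ₗ⁻ : ∀ {x g} → neg₊ g ≤ₗ (- x) → x ≤ᵤ g
neg₊-≤ₗ⁻ {g = fin _} -g≤-x = ℤP.neg-cancel-≤ -g≤-x
neg₊-≤ₗ⁻ {g = +∞}    _     = tt

neg₊-≤₋₊ : ∀ {f g} → f ≤₋₊ g → (f +₋ neg₊ g) ≤ₗ 0ℤ
neg₊-≤₋₊ { -∞} _ = tt
neg₊-≤₋₊ {fin a} {fin b} a≤b = subst (a - b ℤ.≤_) (ℤP.+-inverseʳ b) (ℤP.+-monoˡ-≤ (- b) a≤b)
neg₊-≤₋₊ {fin _} {+∞} _ = tt

allSubset? : ∀ {n} {P : Subset n → Set} → (∀ Z → Dec (P Z)) → Dec (∀ Z → P Z)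
allSubset? P? with anySubset? (¬? ∘ P?)
... | yes (Z , ¬PZ) = no (λ ∀P → ¬PZ (∀P Z))
... | no  ¬∃¬P      = yes (λ Z → decidable-stable (P? Z) (λ ¬PZ → ¬∃¬P (Z , ¬PZ)))

argmax : ∀ {n} (h : Subset n → ℤ₋∞) → ∃ λ X → ∀ Y → h Y ≤₋ h X
argmax {zero} h = [] , λ { [] → ≤₋-refl }
argmax {suc n} h with argmax (h ∘ (inside ∷_)) | argmax (h ∘ (outside ∷_))
... | X , X-max | X' , X'-max with ≤₋-total (h (inside ∷ X)) (h (outside ∷ X'))
...   | inj₁ le = outside ∷ X' , λ { (inside ∷ Y) → ≤₋-trans (X-max Y) le ; (outside ∷ Y) → X'-max Y }
...   | inj₂ ge = inside ∷ X , λ { (inside ∷ Y) → X-max Y ; (outside ∷ Y) → ≤₋-trans (X'-max Y) ge }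

between : ∀ a b → (a +₋ b) ≤ₗ 0ℤ → ∃ λ t → a ≤ₗ t × b ≤ₗ (- t)
between (fin a) -∞      _     = a , ℤP.≤-refl , tt
between -∞      -∞      _     = 0ℤ , tt , tt
between -∞      (fin b) _     = - b , tt , ℤP.≤-reflexive (sym (ℤP.neg-involutive b))
between (fin a) (fin b) a+b≤0 = a , ℤP.≤-refl ,
  subst₂ ℤ._≤_ (lhs a b) (ℤP.+-identityˡ (- a)) (ℤP.+-monoˡ-≤ (- a) a+b≤0)
  where
  lhs : ∀ a b → a + b - a ≡ b
  lhs = solve-∀

-- Only the largest member of each family matters, and there are finitely many. The separation
-- hypothesis at these two says that the greatest lower bound imposed on `t` does not exceed the
-- least upper one; being integers, the bounds themselves serve as witnesses.
between-families : ∀ {n} (h₁ h₂ : Subset n → ℤ₋∞) → (∀ X Y → (h₁ X +₋ h₂ Y) ≤ₗ 0ℤ) →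
  ∃ λ t → (∀ X → h₁ X ≤ₗ t) × (∀ Y → h₂ Y ≤ₗ (- t))
between-families h₁ h₂ sep with argmax h₁ | argmax h₂
... | X , X-max | Y , Y-max with between (h₁ X) (h₂ Y) (sep X Y)
...   | t , X≤t , Y≤-t = t , (λ X' → ≤₋-≤ₗ-trans (X-max X') X≤t) , (λ Y' → ≤₋-≤ₗ-trans (Y-max Y') Y≤-t)

-- Fourier–Motzkin elimination of the flow on edge e: the pairs of one lower and one upper bound
-- coming from a set entered and a set left by e are redundant by supermodularity.
module Eliminate {n m} (tail head : Fin m → Fin n) (e : Fin m) (f : ℤ₋∞) (g : ℤ₊∞) (f≤g : f ≤₋₊ g)
  (p : Subset n → ℤ₋∞) (p-super : Supermodular p) where

  -- Minus the largest net in-flow that a value between `f` and `g` on `e` can bring into `Z`. Hence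
  -- `reduced` is what the other edges must still supply; where `e` can bring in arbitrarily much,
  -- it is -∞ and the constraint vanishes.
  capacity : Subset n → ℤ₋∞
  capacity Z = cutAt tail head e Z (neg₊ g) f (fin 0ℤ)

  reduced : Subset n → ℤ₋∞
  reduced Z = p Z +₋ capacity Z

  -- As for `net-modular`, with equality unless `e` enters one of the sets and leaves the other
  -- while crossing neither intersection nor union. There the left side is f - g, and the right side
  -- 0.
  capacity-super : Supermodular capacity
  capacity-super X Y = subst₂ (λ a b → (capacity X +₋ capacity Y) ≤₋ (a +₋ b))
    (sym (cutAt-∩ tail head e X Y)) (sym (cutAt-∪ tail head e X Y)) (super
      (lookup X (head e)) (lookup X (tail e)) (lookup Y (head e)) (lookup Y (tail e)))
    where
    c : Bool → Bool → ℤ₋∞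
    c h t = cut h t (neg₊ g) f (fin 0ℤ)
    comm : ∀ a b → (a +₋ b) ≤₋ (b +₋ a)
    comm a b = ≤₋-reflexive (+₋-comm a b)
    ≤0 : ∀ {a} → a ≤ₗ 0ℤ → a ≤₋ fin 0ℤ
    ≤0 { -∞} _ = tt
    ≤0 {fin _} a≤0 = a≤0
    super : ∀ h t h' t' → (c h t +₋ c h' t') ≤₋ (c (h ∧ h') (t ∧ t') +₋ c (h ∨ h') (t ∨ t'))
    super true  true  h'    t'    = comm (fin 0ℤ) (c h' t')
    super true  false true  true  = ≤₋-refl
    super true  false true  false = ≤₋-refl
    super true  false false true  = ≤0 (subst (_≤ₗ 0ℤ) (+₋-comm f (neg₊ g)) (neg₊-≤₋₊ f≤g))
    super true  false false false = comm (neg₊ g) (fin 0ℤ)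
    super false true  true  true  = ≤₋-refl
    super false true  true  false = ≤0 (neg₊-≤₋₊ f≤g)
    super false true  false true  = ≤₋-refl
    super false true  false false = comm f (fin 0ℤ)
    super false false h'    t'    = ≤₋-refl

  reduced-super : Supermodular reduced
  reduced-super X Y = subst₂ _≤₋_
    (+₋-interchange (p X) (p Y) (capacity X) (capacity Y))
    (+₋-interchange (p (X ∩ Y)) (p (X ∪ Y)) (capacity (X ∩ Y)) (capacity (X ∪ Y)))
    (+₋-mono (p-super X Y) (capacity-super X Y))

  flow : ℤ → Subset n → ℤ
  flow t Z = cutAt tail head e Z t (- t) 0ℤ

  project : ∀ {t y Z} → f ≤ₗ t → t ≤ᵤ g → p Z ≤ₗ (flow t Z + y) → reduced Z ≤ₗ y
  project {t} {y} {Z} f≤t t≤g pZ≤ = subst (reduced Z ≤ₗ_) (cancel (flow t Z) y)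
    (+ₗ-mono pZ≤ (capacity≤ (lookup Z (head e)) (lookup Z (tail e))))
    where
    cancel : ∀ c y → c + y - c ≡ y
    cancel = solve-∀
    capacity≤ : ∀ h t' → cut h t' (neg₊ g) f (fin 0ℤ) ≤ₗ (- cut h t' t (- t) 0ℤ)
    capacity≤ true  true  = ℤP.≤-refl
    capacity≤ true  false = neg₊-≤ₗ t≤g
    capacity≤ false true  = subst (f ≤ₗ_) (sym (ℤP.neg-involutive t)) f≤t
    capacity≤ false false = ℤP.≤-refl

  lift : ∀ (y : Subset n → ℤ) → (∀ X Y → y X + y Y ≡ y (X ∩ Y) + y (X ∪ Y)) → (∀ Z → reduced Z ≤ₗ y Z) →
    ∃ λ t → f ≤ₗ t × t ≤ᵤ g × (∀ Z → p Z ≤ₗ (flow t Z + y Z))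
  lift y y-modular red≤y with between-families lower upper separated
    where
    lower upper : Subset n → ℤ₋∞
    -- The capacity bounds are folded into the families as default values: a set that `e` does not
    -- enter yields `f`, one that it does not leave yields minus `g`. They are recovered at `Empty`,
    -- which no edge crosses.
    lower Z = cutAt tail head e Z (p Z -ₗ y Z) f f
    upper Z = cutAt tail head e Z (neg₊ g) (p Z -ₗ y Z) (neg₊ g)

    separated : ∀ X Y → (lower X +₋ upper Y) ≤ₗ 0ℤ
    separated X Y = bounds (lookup X (head e)) (lookup X (tail e)) (lookup Y (head e)) (lookup Y (tail e))
      (red≤y X) (red≤y Y)
      (subst (λ c → (p (X ∩ Y) +₋ c) ≤ₗ y (X ∩ Y)) (cutAt-∩ tail head e X Y) (red≤y (X ∩ Y)))
      (subst (λ c → (p (X ∪ Y) +₋ c) ≤ₗ y (X ∪ Y)) (cutAt-∪ tail head e X Y) (red≤y (X ∪ Y)))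
      where
      c : Bool → Bool → ℤ₋∞
      c h t = cut h t (neg₊ g) f (fin 0ℤ)
      bounds : ∀ h t h' t' →
        (p X +₋ c h t) ≤ₗ y X → (p Y +₋ c h' t') ≤ₗ y Y →
        (p (X ∩ Y) +₋ c (h ∧ h') (t ∧ t')) ≤ₗ y (X ∩ Y) → (p (X ∪ Y) +₋ c (h ∨ h') (t ∨ t')) ≤ₗ y (X ∪ Y) →
        (cut h t (p X -ₗ y X) f f +₋ cut h' t' (neg₊ g) (p Y -ₗ y Y) (neg₊ g)) ≤ₗ 0ℤ
      bounds true  true  true  true  _ _ _ _ = neg₊-≤₋₊ f≤g
      bounds true  true  true  false _ _ _ _ = neg₊-≤₋₊ f≤g
      bounds true  true  false true  _ b _ _ = -ₗ-left {p Y} b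
      bounds true  true  false false _ _ _ _ = neg₊-≤₋₊ f≤g
      bounds true  false true  true  a _ _ _ = -ₗ-right {p X} a
      bounds true  false true  false a _ _ _ = -ₗ-right {p X} a
      -- `e` enters X and leaves Y, so it crosses neither X ∩ Y nor X ∪ Y, and `reduced` is `p` on
      -- these two sets. Their constraints add up, by supermodularity of `p` and modularity of `y`,
      -- to the pair required.
      bounds true  false false true  a b c d = -ₗ-pair {p X} {p Y} (≤₋-≤ₗ-trans (p-super X Y)
        (subst₂ _≤ₗ_ (cong₂ _+₋_ (+₋-identityʳ (p (X ∩ Y))) (+₋-identityʳ (p (X ∪ Y)))) (sym (y-modular X Y))
          (+ₗ-mono c d)))
      bounds true  false false false a _ _ _ = -ₗ-right {p X} a
      bounds false true  true  true  _ _ _ _ = neg₊-≤₋₊ f≤g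
      bounds false true  true  false _ _ _ _ = neg₊-≤₋₊ f≤g
      bounds false true  false true  _ b _ _ = -ₗ-left {p Y} b
      bounds false true  false false _ _ _ _ = neg₊-≤₋₊ f≤g
      bounds false false true  true  _ _ _ _ = neg₊-≤₋₊ f≤g
      bounds false false true  false _ _ _ _ = neg₊-≤₋₊ f≤g
      bounds false false false true  _ b _ _ = -ₗ-left {p Y} b
      bounds false false false false _ _ _ _ = neg₊-≤₋₊ f≤g
  ... | t , lower≤t , upper≤-t = t , f≤t , neg₊-≤ₗ⁻ -g≤-t , λ Z →
    extended (lookup Z (head e)) (lookup Z (tail e)) (lower≤t Z) (upper≤-t Z) (red≤y Z)
    where
    Empty-neutral : ∀ {A : Set} {a b c : A} → cutAt tail head e Empty a b c ≡ c
    Empty-neutral rewrite VecP.lookup-replicate (head e) outside | VecP.lookup-replicate (tail e) outside = refl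
    f≤t : f ≤ₗ t
    f≤t = subst (_≤ₗ t) Empty-neutral (lower≤t Empty)
    -g≤-t : neg₊ g ≤ₗ (- t)
    -g≤-t = subst (_≤ₗ (- t)) Empty-neutral (upper≤-t Empty)
    extended : ∀ h t' {Z} → cut h t' (p Z -ₗ y Z) f f ≤ₗ t → cut h t' (neg₊ g) (p Z -ₗ y Z) (neg₊ g) ≤ₗ (- t) →
      (p Z +₋ cut h t' (neg₊ g) f (fin 0ℤ)) ≤ₗ y Z → p Z ≤ₗ (cut h t' t (- t) 0ℤ + y Z)
    neutral : ∀ {Z} → (p Z +₋ fin 0ℤ) ≤ₗ y Z → p Z ≤ₗ (0ℤ + y Z)
    neutral {Z} = subst₂ _≤ₗ_ (+₋-identityʳ (p Z)) (sym (ℤP.+-identityˡ (y Z)))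
    extended true  true  {Z} _ _ r = neutral {Z} r
    extended true  false {Z} l _ _ = -ₗ-elim {p Z} l
    extended false true  {Z} _ u _ = -ₗ-elim {p Z} u
    extended false false {Z} _ _ r = neutral {Z} r

Feasible : ∀ {n m} (tail head : Fin m → Fin n) → (Fin m → ℤ₋∞) → (Fin m → ℤ₊∞) → (Subset n → ℤ₋∞) →
  (Fin m → ℤ) → Set
Feasible tail head f g p x =
  (∀ e → f e ≤ₗ x e) × (∀ e → x e ≤ᵤ g e) × (∀ Z → p Z ≤ₗ net tail head x Z)

feasible? : ∀ {n m} (tail head : Fin m → Fin n) f g → (∀ e → f e ≤₋₊ g e) → ∀ p → Supermodular p →
  Dec (∃ (Feasible tail head f g p))
feasible? {m = zero} tail head f g f≤g p p-super = map′
  (λ p≤0 → (λ ()) , (λ ()) , (λ ()) , p≤0) (λ (_ , _ , _ , p≤0) → p≤0) (allSubset? (λ Z → ≤ₗ? (p Z) 0ℤ))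
feasible? {m = suc m} tail head f g f≤g p p-super = map′ extend shrink
  (feasible? tail' head' (f ∘ suc) (g ∘ suc) (f≤g ∘ suc) reduced reduced-super)
  where
  tail' = tail ∘ suc
  head' = head ∘ suc
  open Eliminate tail head zero (f zero) (g zero) (f≤g zero) p p-super

  shrink : ∃ (Feasible tail head f g p) → ∃ (Feasible tail' head' (f ∘ suc) (g ∘ suc) reduced)
  shrink (x , f≤x , x≤g , p≤) = x ∘ suc , f≤x ∘ suc , x≤g ∘ suc ,
    λ Z → project {x zero} {net tail' head' (x ∘ suc) Z} {Z} (f≤x zero) (x≤g zero) (p≤ Z)

  extend : ∃ (Feasible tail' head' (f ∘ suc) (g ∘ suc) reduced) → ∃ (Feasible tail head f g p)
  extend (x , f≤x , x≤g , red≤) with lift (net tail' head' x) (net-modular tail' head' x) red≤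
  ... | t , f≤t , t≤g , p≤ =
    (λ { zero → t ; (suc e) → x e }) , (λ { zero → f≤t ; (suc e) → f≤x e }) ,
    (λ { zero → t≤g ; (suc e) → x≤g e }) , p≤

-- Jumping edges

-- `i / 1` is normalised through a gcd and is stuck for a variable `i`; this form exposes numerator
-- and denominator.
fromℤ : ℤ → ℚ
fromℤ i = mkℚ i 0 (Coprimality.sym (Coprimality.1-coprimeTo ∣ i ∣))

/1-fromℤ : ∀ i → i ℚ./ 1 ≡ fromℤ i
/1-fromℤ i = ℚP.↥p/↧p≡p (fromℤ i)

/1-+ : ∀ i j → (i + j) ℚ./ 1 ≡ i ℚ./ 1 ℚ.+ j ℚ./ 1
/1-+ i j = begin
  (i + j) ℚ./ 1            ≡⟨ cong (ℚ._/ 1) (cong₂ _+_ (ℤP.*-identityʳ i) (ℤP.*-identityʳ j)) ⟨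
  fromℤ i ℚ.+ fromℤ j  ≡⟨ cong₂ ℚ._+_ (/1-fromℤ i) (/1-fromℤ j) ⟨
  i ℚ./ 1 ℚ.+ j ℚ./ 1      ∎
  where open ≡-Reasoning

/1-mono-≤ : ∀ {i j} → i ℤ.≤ j → i ℚ./ 1 ℚ.≤ j ℚ./ 1
/1-mono-≤ {i} {j} i≤j = subst₂ ℚ._≤_ (sym (/1-fromℤ i)) (sym (/1-fromℤ j)) (ℚ.*≤* (ℤP.*-monoʳ-≤-nonNeg 1ℤ i≤j))

-- A non-negative `i` lies above the constant in any case. For negative `i`, multiplication by a
-- denominator of at least 1 can only lower it, so the numerator of `k` is at most `i`.
/1-bounded-below : ∀ k → ∃ λ c → ∀ i → k ℚ.≤ i ℚ./ 1 → c ℤ.≤ i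
/1-bounded-below k = - ℤ.+ ∣ ↥ k ∣ , bound
  where
  num≤ : ∀ i → k ℚ.≤ i ℚ./ 1 → ↥ k ℤ.≤ i ℤ.* ↧ k
  num≤ i k≤i = subst (ℤ._≤ i ℤ.* ↧ k) (ℤP.*-identityʳ (↥ k)) (ℚP.drop-*≤* (subst (k ℚ.≤_) (/1-fromℤ i) k≤i))
  -∣i∣≤i : ∀ i → - ℤ.+ ∣ i ∣ ℤ.≤ i
  -∣i∣≤i (ℤ.+ n)     = ℤP.neg-≤-pos
  -∣i∣≤i -[1+ n ] = ℤP.≤-refl
  bound : ∀ i → k ℚ.≤ i ℚ./ 1 → - ℤ.+ ∣ ↥ k ∣ ℤ.≤ i
  bound (ℤ.+ n) _ = ℤP.neg-≤-pos
  bound -[1+ n ] k≤i = ℤP.≤-trans (-∣i∣≤i (↥ k)) (ℤP.≤-trans (num≤ -[1+ n ] k≤i)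
    (ℤP.neg-mono-≤ {ℤ.+ suc n} (ℤ.+≤+ (ℕP.m≤m*n (suc n) (ℚ.↧ₙ k)))))

tildeℚ-/1 : ∀ {n} (x : Fin n → ℤ) Z → tildeℚ (λ v → x v ℚ./ 1) Z ≡ tildeℤ x Z ℚ./ 1
tildeℚ-/1 x [] = refl
tildeℚ-/1 x (inside ∷ Z) = trans (cong (x zero ℚ./ 1 ℚ.+_) (tildeℚ-/1 (x ∘ suc) Z)) (sym (/1-+ (x zero) _))
tildeℚ-/1 x (outside ∷ Z) = trans (cong (ℚ.0ℚ ℚ.+_) (tildeℚ-/1 (x ∘ suc) Z)) (sym (/1-+ 0ℤ (tildeℤ (x ∘ suc) Z)))

InBℤ⇒InBℚ : ∀ {n} {p : Subset n → ℤ₋∞} {x} → InBℤ p x → InBℚ p (λ v → x v ℚ./ 1)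
InBℤ⇒InBℚ {p = p} {x} (total , lower) = total′ (p Full) total , λ Z → lower′ (p Z) Z (lower Z)
  where
  total′ : ∀ a → a ≡ₗ tildeℤ x Full → a ≡ℚ tildeℚ (λ v → x v ℚ./ 1) Full
  total′ (fin a) eq = trans (cong (ℚ._/ 1) eq) (sym (tildeℚ-/1 x Full))
  lower′ : ∀ a Z → a ≤ₗ tildeℤ x Z → a ≤ℚ tildeℚ (λ v → x v ℚ./ 1) Z
  lower′ -∞      Z _  = tt
  lower′ (fin a) Z le = subst (a ℚ./ 1 ℚ.≤_) (sym (tildeℚ-/1 x Z)) (/1-mono-≤ le)

finite⇒InCalP : ∀ {n} {p : Subset n → ℤ₋∞} {Z} → p Z ≢ -∞ → InCalP p Z
finite⇒InCalP {p = p} {Z} pZ≢-∞ = lowerBound (p Z) pZ≢-∞ , λ x (_ , lower) → isLower (p Z) pZ≢-∞ (lower Z)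
  where
  lowerBound : ∀ a → a ≢ -∞ → ℚ
  lowerBound -∞      a≢-∞ = contradiction refl a≢-∞
  lowerBound (fin a) _    = a ℚ./ 1
  isLower : ∀ a a≢-∞ {q} → a ≤ℚ q → lowerBound a a≢-∞ ℚ.≤ q
  isLower -∞      a≢-∞ _  = contradiction refl a≢-∞
  isLower (fin a) _    le = le

module _ {n m} (tail head : Fin m → Fin n) {p : Subset n → ℤ₋∞} (p-Full : p Full ≡ fin 0ℤ) where

  net⇒InBℤ : ∀ {x} → (∀ Z → p Z ≤ₗ net tail head x Z) → InBℤ p (ψ tail head x)
  net⇒InBℤ {x} p≤net =
    subst₂ _≡ₗ_ (sym p-Full) (sym (trans (tilde-ψ tail head x Full) (net-Full tail head x))) refl ,
    λ Z → subst (p Z ≤ₗ_) (sym (tilde-ψ tail head x Z)) (p≤net Z)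

InBℤ⇒net : ∀ {n m} (tail head : Fin m → Fin n) {p x} → InBℤ p (ψ tail head x) → ∀ Z → p Z ≤ₗ net tail head x Z
InBℤ⇒net tail head {p} {x} (_ , lower) Z = subst (p Z ≤ₗ_) (tilde-ψ tail head x Z) (lower Z)

∈-lookup : ∀ {n} {v : Fin n} {Z} → v ∈ Z → lookup Z v ≡ inside
∈-lookup = VecP.[]=⇒lookup

∉-lookup : ∀ {n} {v : Fin n} {Z} → v ∉ Z → lookup Z v ≡ outside
∉-lookup {v = v} {Z} v∉Z with lookup Z v in eq
... | inside  = contradiction (VecP.lookup⇒[]= v Z eq) v∉Z
... | outside = refl

-- If every finite set containing u contains v then x₀ + t(χ_v - χ_u) stays in B for all t ≥ 0, so
-- the members of 𝒫 containing u contain v as well. The vector is realised by an extra edge uv.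
finite⇒Jumping : ∀ {n m} (tail head : Fin m → Fin n) {p x u v} → p Full ≡ fin 0ℤ →
  (∀ Z → p Z ≤ₗ net tail head x Z) → u ≢ v → (∀ Z → p Z ≢ -∞ → u ∈ Z → v ∈ Z) → Jumping p u v
finite⇒Jumping {n} {m} tail head {p} {x} {u} {v} p-Full p≤net u≢v finite = u≢v , step
  where
  tail⁺ head⁺ : Fin (suc m) → Fin n
  tail⁺ zero    = u
  tail⁺ (suc e) = tail e
  head⁺ zero    = v
  head⁺ (suc e) = head e
  x⁺ : ℕ → Fin (suc m) → ℤ
  x⁺ t zero    = ℤ.+ t
  x⁺ t (suc e) = x e

  p≤net⁺ : ∀ t Z → p Z ≤ₗ net tail⁺ head⁺ (x⁺ t) Z
  p≤net⁺ t Z with p Z in pZ | p≤net Z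
  ... | -∞    | _ = tt
  ... | fin a | a≤ = ℤP.≤-trans a≤ (subst (ℤ._≤ net tail⁺ head⁺ (x⁺ t) Z) (ℤP.+-identityˡ (net tail head x Z))
      (ℤP.+-monoˡ-≤ (net tail head x Z) (0≤ (u ∈? Z) (v ∈? Z))))
    where
    0≤ : Dec (u ∈ Z) → Dec (v ∈ Z) → 0ℤ ℤ.≤ cut (lookup Z v) (lookup Z u) (ℤ.+ t) (- ℤ.+ t) 0ℤ
    0≤ (yes u∈Z) (yes v∈Z) rewrite ∈-lookup u∈Z | ∈-lookup v∈Z = ℤP.≤-refl
    0≤ (yes u∈Z) (no  v∉Z) = contradiction (finite Z (λ pZ≡-∞ → case trans (sym pZ) pZ≡-∞ of λ ()) u∈Z) v∉Z
    0≤ (no  u∉Z) (yes v∈Z) rewrite ∉-lookup u∉Z | ∈-lookup v∈Z = ℤ.+≤+ ℕ.z≤n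
    0≤ (no  u∉Z) (no  v∉Z) rewrite ∉-lookup u∉Z | ∉-lookup v∉Z = ℤP.≤-refl

  step : ∀ Z → InCalP p Z → u ∈ Z → v ∈ Z
  step Z (k , bound) u∈Z with v ∈? Z
  ... | yes v∈Z = v∈Z
  ... | no  v∉Z with /1-bounded-below k
  ...   | c , below = contradiction (ℤP.≤-trans (c≤ t) drop) (ℤP.<⇒≱ c-1<c)
    where
    -- The new edge leaves `Z`, so `t` units on it lower the net in-flow to net - t. The absolute
    -- value brings this down to at most `c`, and the `suc` one below it.
    t = suc ∣ net tail head x Z - c ∣
    net⁺ : ∀ t → net tail⁺ head⁺ (x⁺ t) Z ≡ - ℤ.+ t + net tail head x Z
    net⁺ t rewrite ∈-lookup u∈Z | ∉-lookup v∉Z = refl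
    c≤ : ∀ t → c ℤ.≤ - ℤ.+ t + net tail head x Z
    c≤ t = subst (c ℤ.≤_) (trans (tilde-ψ tail⁺ head⁺ (x⁺ t) Z) (net⁺ t))
      (below _ (subst (k ℚ.≤_) (tildeℚ-/1 _ Z)
        (bound _ (InBℤ⇒InBℚ (net⇒InBℤ tail⁺ head⁺ p-Full {x⁺ t} (p≤net⁺ t))))))
    drop : - ℤ.+ t + net tail head x Z ℤ.≤ -1ℤ + c
    drop = subst₂ ℤ._≤_
      (lhs (net tail head x Z) c (ℤ.+ ∣ net tail head x Z - c ∣)) (rhs c (ℤ.+ ∣ net tail head x Z - c ∣))
      (ℤP.+-monoˡ-≤ (c - ℤ.+ t) (i≤∣i∣ (net tail head x Z - c)))
      where
      i≤∣i∣ : ∀ i → i ℤ.≤ ℤ.+ ∣ i ∣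
      i≤∣i∣ (ℤ.+ n)    = ℤP.≤-refl
      i≤∣i∣ -[1+ n ] = ℤ.-≤+
      lhs : ∀ y c a → y - c + (c - (1ℤ + a)) ≡ - (1ℤ + a) + y
      lhs = solve-∀
      rhs : ∀ c a → a + (c - (1ℤ + a)) ≡ -1ℤ + c
      rhs = solve-∀
    c-1<c : -1ℤ + c ℤ.< c
    c-1<c = subst (-1ℤ + c ℤ.<_) (ℤP.+-identityˡ c) (ℤP.+-monoˡ-< c { -1ℤ} {0ℤ} ℤ.-<+)

≡-∞? : ∀ a → Dec (a ≡ -∞)
≡-∞? -∞      = yes refl
≡-∞? (fin _) = no λ ()

≡+∞? : ∀ b → Dec (b ≡ +∞)
≡+∞? (fin _) = no λ ()
≡+∞? +∞      = yes refl

module _ {n m} (tail head : Fin m → Fin n) (F : Subset m) (f : Fin m → ℤ₋∞) (g : Fin m → ℤ₊∞)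
  (p : Subset n → ℤ₋∞) where

  -- Only the jumping edges need an argument: `finite⇒Jumping` and `finite⇒InCalP` replace 𝒫 by the
  -- sets of finite value, leaving a check over all subsets.
  starArc? : (∃ λ x → ∀ Z → p Z ≤ₗ net tail head x Z) → p Full ≡ fin 0ℤ →
    ∀ u v → Dec (StarArc tail head F f g p u v)
  starArc? (x , p≤net) p-Full u v = map′ toArc fromArc
    ((¬? (u ≟ v) ×-dec allSubset? (λ Z → ¬? (≡-∞? (p Z)) →-dec (u ∈? Z →-dec v ∈? Z)))
     ⊎-dec (FinP.any? (λ e → ≡-∞? (f e) ×-dec (tail e ≟ u ×-dec head e ≟ v))
     ⊎-dec FinP.any? (λ e → ¬? (e ∈? F) ×-dec (≡+∞? (g e) ×-dec (tail e ≟ v ×-dec head e ≟ u)))))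
    where
    toArc : _ → StarArc tail head F f g p u v
    toArc (inj₁ (u≢v , finite)) = jump (finite⇒Jumping tail head {x = x} p-Full p≤net u≢v finite)
    toArc (inj₂ (inj₁ (e , fe , te , he))) = fwd e fe te he
    toArc (inj₂ (inj₂ (e , e∉F , ge , te , he))) = bwd e e∉F ge te he
    fromArc : StarArc tail head F f g p u v → _
    fromArc (jump (u≢v , step)) = inj₁ (u≢v , λ Z pZ → step Z (finite⇒InCalP pZ))
    fromArc (fwd e fe te he) = inj₂ (inj₁ (e , fe , te , he))
    fromArc (bwd e e∉F ge te he) = inj₂ (inj₂ (e , e∉F , ge , te , he))

-- Circuits through F improve

when-≥0 : ∀ b → 0ℤ ℤ.≤ 1ℤ when b
when-≥0 true  = ℤ.+≤+ ℕ.z≤n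
when-≥0 false = ℤP.≤-refl

when-≤0 : ∀ b → -1ℤ when b ℤ.≤ 0ℤ
when-≤0 true  = ℤ.-≤+
when-≤0 false = ℤP.≤-refl

module _ {n m} {tail head : Fin m → Fin n} {F : Subset m} {f : Fin m → ℤ₋∞} {g : Fin m → ℤ₊∞}
  {p : Subset n → ℤ₋∞} where

  -- A jumping edge moves no edge value: it stands for a direction in which B is unbounded, so it
  -- contributes only to the estimate in `net-shift`.
  shift : ∀ {u v} → StarArc tail head F f g p u v → Fin m → ℤ
  shift (jump _)        _  = 0ℤ
  shift (fwd e _ _ _)   e' = -1ℤ when does (e ≟ e')
  shift (bwd e _ _ _ _) e' = 1ℤ when does (e ≟ e')

  -- The left side is a difference of indicators at the two ends, so that it telescopes around a
  -- circuit. Arcs from A₁ and A₂ attain equality; for a jumping edge the left side is at most 0,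
  -- because a finite `Z` containing `u` contains `v`.
  net-shift : ∀ {u v} (a : StarArc tail head F f g p u v) {Z} → p Z ≢ -∞ →
    (1ℤ when lookup Z u) - (1ℤ when lookup Z v) ℤ.≤ net tail head (shift a) Z
  net-shift {u} {v} (jump (_ , step)) {Z} pZ = subst (_ ℤ.≤_) (sym (net-zero tail head Z)) (≤0 (u ∈? Z))
    where
    ≤0 : Dec (u ∈ Z) → (1ℤ when lookup Z u) - (1ℤ when lookup Z v) ℤ.≤ 0ℤ
    ≤0 (yes u∈Z) rewrite ∈-lookup u∈Z | ∈-lookup (step Z (finite⇒InCalP pZ) u∈Z) = ℤP.≤-refl
    ≤0 (no u∉Z) rewrite ∉-lookup u∉Z with lookup Z v
    ... | true  = ℤ.-≤+
    ... | false = ℤP.≤-refl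
  net-shift (fwd e _ refl refl) {Z} _ = ℤP.≤-reflexive (trans
    (arc (lookup Z (tail e)) (lookup Z (head e))) (sym (net-single tail head e -1ℤ Z)))
    where
    arc : ∀ t h → (1ℤ when t) - (1ℤ when h) ≡ cut h t -1ℤ 1ℤ 0ℤ
    arc true  true  = refl
    arc true  false = refl
    arc false true  = refl
    arc false false = refl
  net-shift (bwd e _ _ refl refl) {Z} _ = ℤP.≤-reflexive (trans
    (arc (lookup Z (tail e)) (lookup Z (head e))) (sym (net-single tail head e 1ℤ Z)))
    where
    arc : ∀ t h → (1ℤ when h) - (1ℤ when t) ≡ cut h t 1ℤ -1ℤ 0ℤ
    arc true  true  = refl
    arc true  false = refl
    arc false true  = refl
    arc false false = refl

  shift-≥0 : ∀ {u v} (a : StarArc tail head F f g p u v) e → f e ≢ -∞ → 0ℤ ℤ.≤ shift a e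
  shift-≥0 (jump _) e _ = ℤP.≤-refl
  shift-≥0 (fwd e' fe' _ _) e fe with e' ≟ e
  ... | yes refl = contradiction fe' fe
  ... | no  _    = ℤP.≤-refl
  shift-≥0 (bwd e' _ _ _ _) e _ = when-≥0 (does (e' ≟ e))

  shift-≤0 : ∀ {u v} (a : StarArc tail head F f g p u v) e → g e ≢ +∞ → shift a e ℤ.≤ 0ℤ
  shift-≤0 (jump _) e _ = ℤP.≤-refl
  shift-≤0 (fwd e' _ _ _) e _ = when-≤0 (does (e' ≟ e))
  shift-≤0 (bwd e' _ ge' _ _) e ge with e' ≟ e
  ... | yes refl = contradiction ge' ge
  ... | no  _    = ℤP.≤-refl

  shift-F-≤0 : ∀ {u v} (a : StarArc tail head F f g p u v) e → e ∈ F → shift a e ℤ.≤ 0ℤ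
  shift-F-≤0 (jump _) e _ = ℤP.≤-refl
  shift-F-≤0 (fwd e' _ _ _) e _ = when-≤0 (does (e' ≟ e))
  shift-F-≤0 (bwd e' e'∉F _ _ _) e e∈F with e' ≟ e
  ... | yes refl = contradiction e∈F e'∉F
  ... | no  _    = ℤP.≤-refl

  shift-FArc-<0 : ∀ {u v} (a : StarArc tail head F f g p u v) → IsFArc a → ∃ λ e → e ∈ F × shift a e ℤ.< 0ℤ
  shift-FArc-<0 (fwd e _ _ _) e∈F = e , e∈F , neg
    where
    neg : -1ℤ when does (e ≟ e) ℤ.< 0ℤ
    neg with e ≟ e
    ... | yes _   = ℤ.-<+
    ... | no  e≢e = contradiction refl e≢e

next-suc : ∀ {k} (i j : Fin (suc k)) → toℕ j ≡ suc (toℕ i) → next i ≡ j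
next-suc {k} i j j≡1+i with suc (toℕ i) ℕ.<? suc k
... | yes lt = FinP.toℕ-injective (trans (FinP.toℕ-fromℕ< lt) (sym j≡1+i))
... | no  ≮  = contradiction (subst (ℕ._< suc k) j≡1+i (FinP.toℕ<n j)) ≮

next-last : ∀ k → next (fromℕ k) ≡ zero
next-last k with suc (toℕ (fromℕ k)) ℕ.<? suc k
... | yes lt = contradiction (subst (ℕ._< k) (FinP.toℕ-fromℕ k) (ℕ.s<s⁻¹ lt)) (ℕP.<-irrefl refl)
... | no  _  = refl

sumℤ-next : ∀ {k} (h : Fin (suc k) → ℤ) → sumℤ (h ∘ next) ≡ sumℤ h
sumℤ-next {k} h = begin
  sumℤ (h ∘ next)                                    ≡⟨ sumℤ-snoc (h ∘ next) ⟩
  sumℤ (h ∘ next ∘ inject₁) + h (next (fromℕ k))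
    ≡⟨ cong₂ _+_ (sumℤ-cong λ i → cong h (next-suc (inject₁ i) (suc i) (cong suc (sym (FinP.toℕ-inject₁ i)))))
                 (cong h (next-last k)) ⟩
  sumℤ (h ∘ suc) + h zero                            ≡⟨ ℤP.+-comm (sumℤ (h ∘ suc)) (h zero) ⟩
  sumℤ h ∎
  where open ≡-Reasoning

circuit-improves : ∀ {n m} (tail head : Fin m → Fin n) {F f g p} → p Full ≡ fin 0ℤ →
  ∀ {z} → InQℤ tail head f g p z →
  HasFCircuit tail head F f g p →
  ∃ λ z' → InQℤ tail head f g p z' × (∀ e → e ∈ F → z' e ℤ.≤ z e) × (∃ λ e → e ∈ F × z' e ℤ.< z e)
circuit-improves {n} {m} tail head {F} {f} {g} {p} p-Full {z} (f≤z , z≤g , z∈B) (k , w , _ , arcs , i₀ , isF) =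
  z' , (f≤z' , z'≤g , net⇒InBℤ tail head p-Full {z'} p≤net') , z'≤z , z'<z
  where
  s : Fin (suc k) → Fin m → ℤ
  s i = shift (arcs i)
  Δ : Fin m → ℤ
  Δ e = sumℤ (λ i → s i e)
  z' : Fin m → ℤ
  z' e = z e + Δ e

  Δ≤0⇒z'≤z : ∀ e → Δ e ℤ.≤ 0ℤ → z' e ℤ.≤ z e
  Δ≤0⇒z'≤z e Δ≤0 = subst (z' e ℤ.≤_) (ℤP.+-identityʳ (z e)) (ℤP.+-monoʳ-≤ (z e) Δ≤0)

  f≤z' : ∀ e → f e ≤ₗ z' e
  f≤z' e with ≡-∞? (f e)
  ... | yes fe = subst (_≤ₗ z' e) (sym fe) tt
  ... | no  fe = ≤ₗ-≤-trans (f≤z e) (subst (ℤ._≤ z' e) (ℤP.+-identityʳ (z e))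
                   (ℤP.+-monoʳ-≤ (z e) (sumℤ-≥0 λ i → shift-≥0 (arcs i) e fe)))

  z'≤g : ∀ e → z' e ≤ᵤ g e
  z'≤g e with ≡+∞? (g e)
  ... | yes ge = subst (z' e ≤ᵤ_) (sym ge) tt
  ... | no  ge = ≤-≤ᵤ-trans (Δ≤0⇒z'≤z e (sumℤ-≤0 λ i → shift-≤0 (arcs i) e ge)) (z≤g e)

  -- Summed over the circuit, the indicator differences vanish since `next` is a cyclic permutation
  -- of the indices.
  net-Δ : ∀ Z → p Z ≢ -∞ → 0ℤ ℤ.≤ net tail head Δ Z
  net-Δ Z pZ = subst₂ ℤ._≤_
    (trans (sumℤ-minus (h ∘ w) (h ∘ w ∘ next))
      (trans (cong (λ c → sumℤ (h ∘ w) - c) (sumℤ-next (h ∘ w))) (ℤP.+-inverseʳ (sumℤ (h ∘ w)))))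
    (sym (net-sum tail head s Z))
    (sumℤ-mono λ i → net-shift (arcs i) pZ)
    where
    h : Fin n → ℤ
    h v = 1ℤ when lookup Z v

  p≤net' : ∀ Z → p Z ≤ₗ net tail head z' Z
  p≤net' Z with ≡-∞? (p Z)
  ... | yes pZ = subst (_≤ₗ net tail head z' Z) (sym pZ) tt
  ... | no  pZ = ≤ₗ-≤-trans (InBℤ⇒net tail head z∈B Z) (subst₂ ℤ._≤_
      (ℤP.+-identityʳ (net tail head z Z)) (sym (net-+ tail head z Δ Z))
      (ℤP.+-monoʳ-≤ (net tail head z Z) (net-Δ Z pZ)))

  z'≤z : ∀ e → e ∈ F → z' e ℤ.≤ z e
  z'≤z e e∈F = Δ≤0⇒z'≤z e (sumℤ-≤0 λ i → shift-F-≤0 (arcs i) e e∈F)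

  z'<z : ∃ λ e → e ∈ F × z' e ℤ.< z e
  z'<z with shift-FArc-<0 (arcs i₀) isF
  ... | e , e∈F , neg = e , e∈F , subst (z' e ℤ.<_) (ℤP.+-identityʳ (z e)) (ℤP.+-monoʳ-< (z e)
      (sumℤ-<0 (λ i → shift-F-≤0 (arcs i) e e∈F) i₀ neg))

-- Cuts from the absence of circuits

∪⁅⁆⁻ : ∀ {n} {S : Subset n} {s v} → v ∈ S ∪ ⁅ s ⁆ → v ∈ S ⊎ v ≡ s
∪⁅⁆⁻ {S = S} {s} v∈ with x∈p∪q⁻ S ⁅ s ⁆ v∈
... | inj₁ v∈S = inj₁ v∈S
... | inj₂ v∈s = inj₂ (x∈⁅y⁆⇒x≡y s v∈s)

module _ {n} (R : Fin n → Fin n → Set) (t : Fin n) where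

  -- Circuits must have distinct vertices. Keeping the whole path inside `S` makes this automatic
  -- during the search: the vertex put in front comes from outside `S`.
  record PathWithin (S : Subset n) (s : Fin n) : Set where
    constructor path
    field
      len    : ℕ
      vertex : Fin (suc len) → Fin n
      inj    : Injective _≡_ _≡_ vertex
      start  : vertex zero ≡ s
      end    : vertex (fromℕ len) ≡ t
      link   : ∀ i j → toℕ j ≡ suc (toℕ i) → R (vertex i) (vertex j)
      inS    : ∀ i → vertex i ∈ S

  weaken : ∀ {S S' s} → S ⊆ S' → PathWithin S s → PathWithin S' s
  weaken S⊆S' (path k w inj start end link inS) = path k w inj start end link (S⊆S' ∘ inS)

  prepend : ∀ {S S' s u} → S ⊆ S' → s ∈ S' → s ∉ S → R s u → PathWithin S u → PathWithin S' s
  prepend {S} {S'} {s} {u} S⊆S' s∈S' s∉S Rsu (path k w inj start end link inS) =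
    path (suc k) w' inj' refl end link' inS'
    where
    w' : Fin (suc (suc k)) → Fin n
    w' zero    = s
    w' (suc i) = w i
    inj' : Injective _≡_ _≡_ w'
    inj' {zero}  {zero}  _  = refl
    inj' {zero}  {suc j} eq = contradiction (subst (_∈ S) (sym eq) (inS j)) s∉S
    inj' {suc i} {zero}  eq = contradiction (subst (_∈ S) eq (inS i)) s∉S
    inj' {suc i} {suc j} eq = cong suc (inj eq)
    link' : ∀ i j → toℕ j ≡ suc (toℕ i) → R (w' i) (w' j)
    link' zero    (suc zero) _  = subst (R s) (sym start) Rsu
    link' (suc i) (suc j)    eq = link i j (ℕP.suc-injective eq)
    inS' : ∀ i → w' i ∈ S'
    inS' zero    = s∈S'
    inS' (suc i) = S⊆S' (inS i)

  backwardSearch : (∀ u v → Dec (R u v)) →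
    ∃ λ S → t ∈ S × (∀ s → s ∈ S → PathWithin S s) × (∀ s u → s ∉ S → u ∈ S → ¬ R s u)
  backwardSearch R? = grow ⁅ t ⁆ (⊃-wellFounded ⁅ t ⁆) (x∈⁅x⁆ t) trivial
    where
    trivial : ∀ s → s ∈ ⁅ t ⁆ → PathWithin ⁅ t ⁆ s
    trivial s s∈ = path 0 (λ _ → t) (λ { {zero} {zero} _ → refl }) (sym (x∈⁅y⁆⇒x≡y t s∈)) refl
      (λ { zero zero () }) (λ _ → x∈⁅x⁆ t)
    grow : ∀ S → Acc _⊃_ S → t ∈ S → (∀ s → s ∈ S → PathWithin S s) →
      ∃ λ S → t ∈ S × (∀ s → s ∈ S → PathWithin S s) × (∀ s u → s ∉ S → u ∈ S → ¬ R s u)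
    grow S (acc rec) t∈S paths with FinP.any? (λ s → FinP.any? (λ u → ¬? (s ∈? S) ×-dec (u ∈? S ×-dec R? s u)))
    ... | no ¬∃ = S , t∈S , paths , λ s u s∉S u∈S Rsu → ¬∃ (s , u , s∉S , u∈S , Rsu)
    ... | yes (s , u , s∉S , u∈S , Rsu) =
      grow (S ∪ ⁅ s ⁆) (rec (S⊆ , s , s∈ , s∉S)) (S⊆ t∈S) paths'
      where
      S⊆ : S ⊆ S ∪ ⁅ s ⁆
      S⊆ = p⊆p∪q ⁅ s ⁆
      s∈ : s ∈ S ∪ ⁅ s ⁆
      s∈ = q⊆p∪q S ⁅ s ⁆ (x∈⁅x⁆ s)
      paths' : ∀ v → v ∈ S ∪ ⁅ s ⁆ → PathWithin (S ∪ ⁅ s ⁆) v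
      paths' v v∈ with ∪⁅⁆⁻ v∈
      ... | inj₁ v∈S  = weaken S⊆ (paths v v∈S)
      ... | inj₂ refl = prepend S⊆ s∈ s∉S Rsu (paths u u∈S)

+₋-finite : ∀ {a b} → a ≢ -∞ → b ≢ -∞ → a +₋ b ≢ -∞
+₋-finite { -∞}           a≢ _  = λ _ → a≢ refl
+₋-finite {fin _} { -∞}   _  b≢ = λ _ → b≢ refl
+₋-finite {fin _} {fin _} _  _  = λ ()

≤₋-finite : ∀ {a b c} → a ≢ -∞ → a ≤₋ (b +₋ c) → b ≢ -∞ × c ≢ -∞
≤₋-finite { -∞} a≢ _ = contradiction refl a≢
≤₋-finite {fin _} {fin _} {fin _} _ _ = (λ ()) , (λ ())

module _ {n} {p : Subset n → ℤ₋∞} (p-super : Supermodular p) where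

  ∩∪-finite : ∀ X Y → p X ≢ -∞ → p Y ≢ -∞ → p (X ∩ Y) ≢ -∞ × p (X ∪ Y) ≢ -∞
  ∩∪-finite X Y pX pY = ≤₋-finite (+₋-finite pX pY) (p-super X Y)

  -- X is the union over u ∈ X of the intersections over v ∉ X of the separating sets, and finite
  -- sets are closed under both operations by supermodularity.
  closed⇒finite : p Empty ≢ -∞ → p Full ≢ -∞ → ∀ {X} →
    (∀ u v → u ∈ X → v ∉ X → ∃ λ Z → p Z ≢ -∞ × u ∈ Z × v ∉ Z) → p X ≢ -∞
  closed⇒finite p-Empty p-Full {X} separate with unite id
    where
    intersect : ∀ {k} (φ : Fin k → Fin n) u → u ∈ X →
      ∃ λ Z → p Z ≢ -∞ × u ∈ Z × (∀ i → φ i ∉ X → φ i ∉ Z)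
    intersect {zero}  φ u u∈X = Full , p-Full , ∈⊤ , λ ()
    intersect {suc k} φ u u∈X with intersect (φ ∘ suc) u u∈X | φ zero ∈? X
    ... | Z , pZ , u∈Z , avoid | yes φ0∈X = Z , pZ , u∈Z ,
      λ { zero φ0∉X → contradiction φ0∈X φ0∉X ; (suc i) → avoid i }
    ... | Z , pZ , u∈Z , avoid | no  φ0∉X with separate u (φ zero) u∈X φ0∉X
    ...   | Y , pY , u∈Y , φ0∉Y = Y ∩ Z , proj₁ (∩∪-finite Y Z pY pZ) , x∈p∩q⁺ (u∈Y , u∈Z) ,
      λ { zero _ → φ0∉Y ∘ proj₁ ∘ x∈p∩q⁻ Y Z ; (suc i) ∉X → avoid i ∉X ∘ proj₂ ∘ x∈p∩q⁻ Y Z }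

    unite : ∀ {k} (φ : Fin k → Fin n) →
      ∃ λ Z → p Z ≢ -∞ × (∀ v → v ∉ X → v ∉ Z) × (∀ i → φ i ∈ X → φ i ∈ Z)
    unite {zero}  φ = Empty , p-Empty , (λ _ _ → ∉⊥) , λ ()
    unite {suc k} φ with unite (φ ∘ suc) | φ zero ∈? X
    ... | Z , pZ , avoid , cover | no  φ0∉X = Z , pZ , avoid ,
      λ { zero φ0∈X → contradiction φ0∈X φ0∉X ; (suc i) → cover i }
    ... | Z , pZ , avoid , cover | yes φ0∈X with intersect id (φ zero) φ0∈X
    ...   | Y , pY , φ0∈Y , avoidY = Y ∪ Z , proj₂ (∩∪-finite Y Z pY pZ) ,
      (λ v v∉X v∈Y∪Z → case x∈p∪q⁻ Y Z v∈Y∪Z of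
        λ { (inj₁ v∈Y) → avoidY v v∉X v∈Y ; (inj₂ v∈Z) → avoid v v∉X v∈Z }) ,
      λ { zero _ → p⊆p∪q Z φ0∈Y ; (suc i) ∈X → q⊆p∪q Y Z (cover i ∈X) }
  ... | Z , pZ , avoid , cover = subst (λ Z → p Z ≢ -∞)
    (⊆-antisym (λ {v} v∈Z → decidable-stable (v ∈? X) (λ v∉X → avoid v v∉X v∈Z)) (λ {v} → cover v)) pZ

module _ {n m} (tail head : Fin m → Fin n) {F : Subset m} {f : Fin m → ℤ₋∞} {g : Fin m → ℤ₊∞}
  {p : Subset n → ℤ₋∞} where

  Arc : Fin n → Fin n → Set
  Arc = StarArc tail head F f g p

  closePath : ∀ {e S} → e ∈ F → f e ≡ -∞ → PathWithin Arc (tail e) S (head e) → HasFCircuit tail head F f g p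
  closePath {e} e∈F fe (path k w inj start end link _) =
    k , w , inj , proj₁ ∘ arc , fromℕ k , proj₂ (arc (fromℕ k)) refl
    where
    -- The arc of the last index is `e` itself, leading from the end of the path back to its start.
    -- The second component remembers that it lies in F, so the index test need not be unfolded
    -- again.
    arc : ∀ i → Σ (Arc (w i) (w (next i))) λ a → i ≡ fromℕ k → IsFArc a
    arc i with i ≟ fromℕ k
    ... | yes refl = fwd e fe (sym end) (sym (trans (cong w (next-last k)) start)) , λ _ → e∈F
    ... | no  i≢k  = link i (next i) toℕ-next , λ i≡k → contradiction i≡k i≢k
      where
      i<k : suc (toℕ i) ℕ.< suc k
      i<k = ℕ.s<s (ℕP.≤∧≢⇒< (ℕ.s≤s⁻¹ (FinP.toℕ<n i))
        (λ eq → i≢k (FinP.toℕ-injective (trans eq (sym (FinP.toℕ-fromℕ k))))))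
      toℕ-next : toℕ (next i) ≡ suc (toℕ i)
      toℕ-next = trans (cong toℕ (next-suc i (fromℕ< i<k) (FinP.toℕ-fromℕ< i<k))) (FinP.toℕ-fromℕ< i<k)

  -- An arc leaving X would enter the set found by `backwardSearch`. In particular no jumping edge
  -- leaves X, so any vertex inside and any outside are separated by a set of finite value, as
  -- `closed⇒finite` asks.
  closedCut : p Empty ≡ fin 0ℤ → p Full ≡ fin 0ℤ → Supermodular p →
    (∃ λ x → ∀ Z → p Z ≤ₗ net tail head x Z) → ¬ HasFCircuit tail head F f g p →
    ∀ e → e ∈ F → f e ≡ -∞ →
    ∃ λ X → p X ≢ -∞ × head e ∈ X × tail e ∉ X × (∀ u v → u ∈ X → v ∉ X → ¬ Arc u v)
  closedCut p-Empty p-Full p-super x@(x₀ , p≤net) ¬circuit e e∈F fe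
    with backwardSearch Arc (tail e) (starArc? tail head F f g p x p-Full)
  ... | S , te∈S , paths , ¬arc = ∁ S , closed⇒finite p-super (finite p-Empty) (finite p-Full) separate ,
    x∉p⇒x∈∁p (λ he∈S → ¬circuit (closePath e∈F fe (paths (head e) he∈S))) , x∈p⇒x∉∁p te∈S , leaves
    where
    finite : ∀ {a} → a ≡ fin 0ℤ → a ≢ -∞
    finite refl ()
    leaves : ∀ u v → u ∈ ∁ S → v ∉ ∁ S → ¬ Arc u v
    leaves u v u∈ v∉ = ¬arc u v (x∈∁p⇒x∉p u∈) (x∉∁p⇒x∈p v∉)
    separate : ∀ u v → u ∈ ∁ S → v ∉ ∁ S → ∃ λ Z → p Z ≢ -∞ × u ∈ Z × v ∉ Z
    separate u v u∈ v∉ with anySubset? (λ Z → ¬? (≡-∞? (p Z)) ×-dec (u ∈? Z ×-dec ¬? (v ∈? Z)))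
    ... | yes found = found
    ... | no  ¬found = contradiction (jump (finite⇒Jumping tail head {x = x₀} p-Full p≤net (λ { refl → v∉ u∈ })
      (λ Z pZ u∈Z → decidable-stable (v ∈? Z) (λ v∉Z → ¬found (Z , pZ , u∈Z , v∉Z))))) (leaves u v u∈ v∉)

  private
    InQ : (Fin m → ℤ) → Set
    InQ = InQℤ tail head f g p

  -- An unbounded term would yield an arc leaving X: from A₁ if an edge leaving X has no lower
  -- bound, from A₂ if an edge off F entering X has no upper bound. For an edge of F entering X the
  -- bound is `M`.
  term-bounded : ∀ {X} → (∀ u v → u ∈ X → v ∉ X → ¬ Arc u v) → ∀ M e →
    ∃ λ b → ∀ x → InQ x → (∀ e → e ∈ F → x e ℤ.≤ M) → cutAt tail head e X (x e) (- x e) 0ℤ ℤ.≤ b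
  term-bounded {X} ¬arc M e with head e ∈? X | tail e ∈? X
  ... | yes h∈ | yes t∈ rewrite ∈-lookup h∈ | ∈-lookup t∈ = 0ℤ , λ _ _ _ → ℤP.≤-refl
  ... | no  h∉ | no  t∉ rewrite ∉-lookup h∉ | ∉-lookup t∉ = 0ℤ , λ _ _ _ → ℤP.≤-refl
  ... | no  h∉ | yes t∈ rewrite ∉-lookup h∉ | ∈-lookup t∈ with f e in fe
  ...   | -∞    = contradiction (fwd e fe refl refl) (¬arc _ _ t∈ h∉)
  ...   | fin a = - a , λ x (f≤x , _) _ → ℤP.neg-mono-≤ (subst (_≤ₗ x e) fe (f≤x e))
  term-bounded {X} ¬arc M e | yes h∈ | no  t∉ rewrite ∈-lookup h∈ | ∉-lookup t∉ with e ∈? F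
  ...   | yes e∈F = M , λ _ _ x≤M → x≤M e e∈F
  ...   | no  e∉F with g e in ge
  ...     | +∞    = contradiction (bwd e e∉F ge refl refl) (¬arc _ _ h∈ t∉)
  ...     | fin b = b , λ x (_ , x≤g , _) _ → subst (x e ≤ᵤ_) ge (x≤g e)

  F-bounded-below : p Empty ≡ fin 0ℤ → p Full ≡ fin 0ℤ → Supermodular p →
    (∃ λ x → ∀ Z → p Z ≤ₗ net tail head x Z) → ¬ HasFCircuit tail head F f g p → ∀ M e → e ∈ F →
    ∃ λ l → ∀ x → InQ x → (∀ e → e ∈ F → x e ℤ.≤ M) → l ℤ.≤ x e
  F-bounded-below p-Empty p-Full p-super x ¬circuit M e e∈F with f e in fe
  ... | fin a = a , λ x (f≤x , _) _ → subst (_≤ₗ x e) fe (f≤x e)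
  ... | -∞ with closedCut p-Empty p-Full p-super x ¬circuit e e∈F fe
  ...   | X , pX≢-∞ , h∈ , t∉ , ¬arc with p X in pX
  ...     | -∞    = contradiction refl pX≢-∞
  -- `a` = p(X) is at most the sum of all terms; `e` enters X and contributes `x e`, every other
  -- edge at most its bound in `b`.
  ...     | fin a = a - (sumℤ b - b e) , below
    where
    b : Fin m → ℤ
    b e = proj₁ (term-bounded ¬arc M e)
    below : ∀ x → InQ x → (∀ e → e ∈ F → x e ℤ.≤ M) → a - (sumℤ b - b e) ℤ.≤ x e
    below x x∈Q@(_ , _ , x∈B) x≤M = subst₂ ℤ._≤_
      (lhs (b e) (c e) a (sumℤ b)) (trans (rhs (sumℤ b) (c e)) ce≡xe)
      (ℤP.+-monoˡ-≤ (c e - sumℤ b) (subst (b e - c e + a ℤ.≤_) (cancel (sumℤ b) (sumℤ c))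
        (ℤP.+-mono-≤ be-ce≤ (subst (_≤ₗ sumℤ c) pX (InBℤ⇒net tail head x∈B X)))))
      where
      c : Fin m → ℤ
      c e = cutAt tail head e X (x e) (- x e) 0ℤ
      ce≡xe : c e ≡ x e
      ce≡xe rewrite ∈-lookup h∈ | ∉-lookup t∉ = refl
      be-ce≤ : b e - c e ℤ.≤ sumℤ b - sumℤ c
      be-ce≤ = subst (b e - c e ℤ.≤_) (sumℤ-minus b c) (summand≤sumℤ
        (λ e → ℤP.i≤j⇒0≤j-i (proj₂ (term-bounded ¬arc M e) x x∈Q x≤M)) e)
      cancel : ∀ s c → s - c + c ≡ s
      cancel = solve-∀
      lhs : ∀ b c a s → b - c + a + (c - s) ≡ a - (s - b)
      lhs = solve-∀
      rhs : ∀ s c → s + (c - s) ≡ c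
      rhs = solve-∀

-- Choice among finitely many restrictions

range : ℤ → ℤ → List ℤ
range l u = List.map (λ j → l + ℤ.+ j) (upTo (suc ∣ u - l ∣))

∈-range : ∀ {l u i} → l ℤ.≤ i → i ℤ.≤ u → i ∈ₗ range l u
∈-range {l} {u} {i} l≤i i≤u = subst (_∈ₗ range l u) i≡ (∈ₗP.∈-map⁺ (λ j → l + ℤ.+ j) (∈ₗP.∈-upTo⁺ (ℕ.s≤s ∣∣≤)))
  where
  0≤i-l : 0ℤ ℤ.≤ i - l
  0≤i-l = ℤP.i≤j⇒0≤j-i l≤i
  i-l≤u-l : i - l ℤ.≤ u - l
  i-l≤u-l = ℤP.+-monoˡ-≤ (- l) i≤u
  ∣∣≤ : ∣ i - l ∣ ℕ.≤ ∣ u - l ∣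
  ∣∣≤ = ℤP.drop‿+≤+ (subst₂ ℤ._≤_ (sym (ℤP.0≤i⇒+∣i∣≡i 0≤i-l))
    (sym (ℤP.0≤i⇒+∣i∣≡i (ℤP.≤-trans 0≤i-l i-l≤u-l))) i-l≤u-l)
  cancel : ∀ l i → l + (i - l) ≡ i
  cancel = solve-∀
  i≡ : l + ℤ.+ ∣ i - l ∣ ≡ i
  i≡ = trans (cong (l +_) (ℤP.0≤i⇒+∣i∣≡i 0≤i-l)) (cancel l i)

AgreeOn : ∀ {m} → Subset m → (Fin m → ℤ) → (Fin m → ℤ) → Set
AgreeOn F x y = ∀ e → e ∈ F → x e ≡ y e

-- A member stands for a restriction to F, with 0 filled in elsewhere. Elements of Q are therefore
-- compared with it by `AgreeOn`.
box : ∀ {m} → Subset m → (Fin m → ℤ) → ℤ → List (Fin m → ℤ)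
box []            l M = (λ ()) ∷ []
box (outside ∷ F) l M = List.map (0ℤ Vector.∷_) (box F (l ∘ suc) M)
box (inside  ∷ F) l M = cartesianProductWith Vector._∷_ (range (l zero) M) (box F (l ∘ suc) M)

box-complete : ∀ {m} (F : Subset m) {l M x} → (∀ e → e ∈ F → l e ℤ.≤ x e) → (∀ e → e ∈ F → x e ℤ.≤ M) →
  ∃ λ y → y ∈ₗ box F l M × AgreeOn F x y
box-complete [] _ _ = (λ ()) , here refl , λ ()
box-complete (outside ∷ F) l≤x x≤M with box-complete F (λ e → l≤x (suc e) ∘ there) (λ e → x≤M (suc e) ∘ there)
... | y , y∈ , x≗y = 0ℤ Vector.∷ y , ∈ₗP.∈-map⁺ (0ℤ Vector.∷_) y∈ , λ { (suc e) (there e∈F) → x≗y e e∈F }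
box-complete (inside ∷ F) {x = x} l≤x x≤M
  with box-complete F (λ e → l≤x (suc e) ∘ there) (λ e → x≤M (suc e) ∘ there)
... | y , y∈ , x≗y = x zero Vector.∷ y ,
  ∈ₗP.∈-cartesianProductWith⁺ Vector._∷_ (∈-range (l≤x zero here) (x≤M zero here)) y∈ ,
  λ { zero here → refl ; (suc e) (there e∈F) → x≗y e e∈F }

upperBound : ∀ {m} (x : Fin m → ℤ) → ∃ λ M → ∀ e → x e ℤ.≤ M
upperBound {zero}  x = 0ℤ , λ ()
upperBound {suc m} x with upperBound (x ∘ suc)
... | M , x≤M = x zero ℤ.⊔ M , λ { zero → ℤP.i≤i⊔j (x zero) M
                                  ; (suc e) → ℤP.≤-trans (x≤M e) (ℤP.i≤j⊔i (x zero) M) }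

≤ᵤ? : ∀ x b → Dec (x ≤ᵤ b)
≤ᵤ? x (fin b) = x ℤ.≤? b
≤ᵤ? x +∞      = yes tt

module _ {n m} (tail head : Fin m → Fin n) (F : Subset m) (f : Fin m → ℤ₋∞) (g : Fin m → ℤ₊∞)
  (p : Subset n → ℤ₋∞) where

  private
    InQ : (Fin m → ℤ) → Set
    InQ = InQℤ tail head f g p

  -- Collapsing both bounds to `y e` on F turns extendability into plain feasibility. The collapsed
  -- bounds forget `f` and `g` on F, hence the test of `y` against them beforehand.
  realisable? : (∀ e → f e ≤₋₊ g e) → p Full ≡ fin 0ℤ → Supermodular p →
    ∀ y → Dec (∃ λ x → InQ x × AgreeOn F x y)
  realisable? f≤g p-Full p-super y
    with FinP.all? (λ e → (e ∈? F) →-dec (≤ₗ? (f e) (y e) ×-dec ≤ᵤ? (y e) (g e)))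
  ... | no ¬bounds = no λ (x , (f≤x , x≤g , _) , x≗y) → ¬bounds λ e e∈F →
    subst (f e ≤ₗ_) (x≗y e e∈F) (f≤x e) , subst (_≤ᵤ g e) (x≗y e e∈F) (x≤g e)
  ... | yes bounds = map′ relax fix (feasible? tail head f′ g′ f′≤g′ p p-super)
    where
    f′ : Fin m → ℤ₋∞
    f′ e = if does (e ∈? F) then fin (y e) else f e
    g′ : Fin m → ℤ₊∞
    g′ e = if does (e ∈? F) then fin (y e) else g e
    f′≤g′ : ∀ e → f′ e ≤₋₊ g′ e
    f′≤g′ e with e ∈? F
    ... | yes _ = ℤP.≤-refl
    ... | no  _ = f≤g e
    relax : ∃ (Feasible tail head f′ g′ p) → ∃ λ x → InQ x × AgreeOn F x y
    relax (x , f′≤x , x≤g′ , p≤net) = x , (f≤x , x≤g , net⇒InBℤ tail head p-Full {x} p≤net) , x≗y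
      where
      x≗y : AgreeOn F x y
      x≗y e e∈F with e ∈? F | f′≤x e | x≤g′ e
      ... | yes _   | y≤x | x≤y = ℤP.≤-antisym x≤y y≤x
      ... | no  e∉F | _   | _   = contradiction e∈F e∉F
      f≤x : ∀ e → f e ≤ₗ x e
      f≤x e with e ∈? F | f′≤x e
      ... | yes e∈F | y≤x = ≤ₗ-≤-trans (proj₁ (bounds e e∈F)) y≤x
      ... | no  _   | le  = le
      x≤g : ∀ e → x e ≤ᵤ g e
      x≤g e with e ∈? F | x≤g′ e
      ... | yes e∈F | x≤y = ≤-≤ᵤ-trans x≤y (proj₂ (bounds e e∈F))
      ... | no  _   | le  = le
    fix : (∃ λ x → InQ x × AgreeOn F x y) → ∃ (Feasible tail head f′ g′ p)
    fix (x , (f≤x , x≤g , x∈B) , x≗y) = x , f′≤x , x≤g′ , InBℤ⇒net tail head x∈B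
      where
      f′≤x : ∀ e → f′ e ≤ₗ x e
      f′≤x e with e ∈? F
      ... | yes e∈F = ℤP.≤-reflexive (sym (x≗y e e∈F))
      ... | no  _   = f≤x e
      x≤g′ : ∀ e → x e ≤ᵤ g′ e
      x≤g′ e with e ∈? F
      ... | yes e∈F = ℤP.≤-reflexive (x≗y e e∈F)
      ... | no  _   = x≤g e

module _ {m} (F : Subset m) {S : (Fin m → ℤ) → Set} {M : ℤ} where

  BelowOn : (Fin m → ℤ) → Set
  BelowOn x = ∀ e → e ∈ F → x e ℤ.≤ M

  -- The scan starts at the given element, whose restriction may be missing from the list, and
  -- replaces the current element only by a decreasingly smaller one; so the bound `M` on F is kept.
  decMin-among : (∀ y → Dec (∃ λ x → S x × AgreeOn F x y)) → (ys : List (Fin m → ℤ)) →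
    (∃ λ x → S x × BelowOn x) →
    ∃ λ z → S z × BelowOn z × (∀ {y} → y ∈ₗ ys → ∀ x → S x → AgreeOn F x y → ¬ DecSmaller F x z)
  decMin-among real? [] (x , x∈S , x≤M) = x , x∈S , x≤M , λ ()
  decMin-among real? (y ∷ ys) x₀ with decMin-among real? ys x₀ | real? y
  ... | z , z∈S , z≤M , z-min | no ¬real = z , z∈S , z≤M ,
    λ { (here refl) x x∈S x≗y _ → ¬real (x , x∈S , x≗y) ; (there y∈) → z-min y∈ }
  ... | z , z∈S , z≤M , z-min | yes (w , w∈S , w≗y)
    with sortDec (restrict F w) <lex? sortDec (restrict F z)
  ...   | yes w<z = w , w∈S , decSmaller-bound F w<z z≤M ,
    λ { (here refl) x _ x≗y x<w → <lex-irrefl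
          (subst (_<lex sortDec (restrict F w)) (cong sortDec (sym (agree w≗y x≗y))) x<w)
      ; (there y∈) x x∈S x≗y x<w → z-min y∈ x x∈S x≗y (<lex-trans x<w w<z) }
    where
    agree : ∀ {x y z} → AgreeOn F x z → AgreeOn F y z → restrict F x ≡ restrict F y
    agree x≗z y≗z = restrict-cong F (λ e e∈F → trans (x≗z e e∈F) (sym (y≗z e e∈F)))
  ...   | no  w≮z = z , z∈S , z≤M ,
    λ { (here refl) x _ x≗y x<z → w≮z (subst (_<lex sortDec (restrict F z))
          (cong sortDec (restrict-cong F (λ e e∈F → trans (x≗y e e∈F) (sym (w≗y e e∈F))))) x<z)
      ; (there y∈) → z-min y∈ }

theorem6p2 : ∀ {n m : ℕ} (tail head : Fin m → Fin n) → (∀ e → tail e ≢ head e) →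
    (F : Subset m) → Nonempty F →
    (p : Subset n → ℤ₋∞) → p Empty ≡ fin 0ℤ → p Full ≡ fin 0ℤ → Supermodular p →
    (f : Fin m → ℤ₋∞) → (g : Fin m → ℤ₊∞) → (∀ e → f e ≤₋₊ g e) →
    ∃ (InQℤ tail head f g p) →
    (∃ (FDecMin F (InQℤ tail head f g p)) ⇔ (¬ HasFCircuit tail head F f g p))
theorem6p2 {m = m} tail head _ F _ p p-Empty p-Full p-super f g f≤g (x₀ , x₀∈Q) = mk⇔ noCircuit decMin
  where
  noCircuit : ∃ (FDecMin F (InQℤ tail head f g p)) → ¬ HasFCircuit tail head F f g p
  noCircuit (z , z∈Q , z-min) circuit with circuit-improves tail head p-Full z∈Q circuit
  ... | z' , z'∈Q , z'≤z , e , e∈F , z'e<ze = z-min (z' , z'∈Q , decSmaller-pointwise F z'≤z e e∈F z'e<ze)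

  decMin : ¬ HasFCircuit tail head F f g p → ∃ (FDecMin F (InQℤ tail head f g p))
  decMin ¬circuit = z , z∈Q , λ (z' , z'∈Q , z'<z) →
    -- A competitor below `z` inherits the bound `M`, which activates the lower bounds; its
    -- restriction then occurs in the box, where `z` was already compared with it.
    let z'≤M = decSmaller-bound F z'<z z≤M
        y , y∈ , z'≗y = box-complete F (λ e e∈F → proj₂ (lower e) e∈F z' z'∈Q z'≤M) z'≤M
    in z-min y∈ z' z'∈Q z'≗y z'<z
    where
    M = proj₁ (upperBound x₀)
    x₀≤M = proj₂ (upperBound x₀)
    lower : ∀ e → ∃ λ l → e ∈ F → ∀ x → InQℤ tail head f g p x → (∀ e → e ∈ F → x e ℤ.≤ M) → l ℤ.≤ x e
    lower e with e ∈? F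
    ... | no e∉F  = 0ℤ , λ e∈F → contradiction e∈F e∉F
    ... | yes e∈F with F-bounded-below tail head p-Empty p-Full p-super
                         (x₀ , InBℤ⇒net tail head (proj₂ (proj₂ x₀∈Q))) ¬circuit M e e∈F
    ...   | l , l≤ = l , λ _ → l≤
    best = decMin-among F (realisable? tail head F f g p f≤g p-Full p-super) (box F (proj₁ ∘ lower) M)
             (x₀ , x₀∈Q , λ e _ → x₀≤M e)
    z = proj₁ best
    z∈Q = proj₁ (proj₂ best)
    z≤M = proj₁ (proj₂ (proj₂ best))
    z-min = proj₂ (proj₂ (proj₂ best))
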